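{- For every integer $k \geq 1$, $$ gr_{k}(K_{3}:W_{5})=\begin{cases} 5 & \text{ if $k = 1$,}\\ 14\cdot5^{\frac{k-2}{2}}+1 & \text{ if $k$ is even,}\\ 28\cdot5^{\frac{k-3}{2}}+1 & \text{ if $k \geq 3$ is odd.} \end{cases} $$
   Context: The wheel $W_5 = K_1 \vee C_4$ is the graph on $5$ vertices consisting of a $4$-cycle and a vertex adjacent to all four cycle vertices. For graphs $G$, $H$ and a positive integer $k$, the Gallai-Ramsey number $gr_k(G:H)$ is the minimum integer $m$ such that every coloring of the edges of $K_m$ using at most $k$ colors contains either a rainbow copy of $G$ (all edges receiving distinct colors) or a monochromatic copy of $H$. -}

module Defs where

open import Data.Nat using (ℕ; _<_; _+_; _*_; _^_)
open import Data.Fin using (Fin)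
open import Data.Sum using (_⊎_)
open import Data.Product using (Σ; _×_; ∃-syntax)
open import Relation.Binary.PropositionalEquality using (_≡_; _≢_)
open import Relation.Nullary using (¬_)

-- An edge-colouring of the complete graph K_m using at most k colours:
-- a symmetric function on ordered pairs of vertices (diagonal values are irrelevant).
record Colouring (m k : ℕ) : Set where
  field
    col : Fin m → Fin m → Fin k
    sym : ∀ i j → col i j ≡ col j i
open Colouring public

RainbowK3 : ∀ {m k} → Colouring m k → Set
RainbowK3 {m} c =
  Σ (Fin m) λ a → Σ (Fin m) λ b → Σ (Fin m) λ d →
    (a ≢ b × b ≢ d × a ≢ d) ×
    (col c a b ≢ col c b d × col c b d ≢ col c a d × col c a b ≢ col c a d)

-- A monochromatic W₅ = K₁ ∨ C₄: five distinct vertices, hub h and 4-cycle v0 v1 v2 v3,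
-- such that the 4 cycle edges and the 4 spokes all have the same colour x.
MonoW5 : ∀ {m k} → Colouring m k → Set
MonoW5 {m} {k} c =
  Σ (Fin k) λ x → Σ (Fin m) λ h →
  Σ (Fin m) λ v0 → Σ (Fin m) λ v1 → Σ (Fin m) λ v2 → Σ (Fin m) λ v3 →
    (h ≢ v0 × h ≢ v1 × h ≢ v2 × h ≢ v3 ×
     v0 ≢ v1 × v0 ≢ v2 × v0 ≢ v3 × v1 ≢ v2 × v1 ≢ v3 × v2 ≢ v3) ×
    (col c v0 v1 ≡ x × col c v1 v2 ≡ x × col c v2 v3 ≡ x × col c v3 v0 ≡ x ×
     col c h v0 ≡ x × col c h v1 ≡ x × col c h v2 ≡ x × col c h v3 ≡ x)

Arrows : ℕ → ℕ → Set
Arrows k m = (c : Colouring m k) → RainbowK3 c ⊎ MonoW5 c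

IsGR-K3-W5 : ℕ → ℕ → Set
IsGR-K3-W5 k n = Arrows k n × (∀ m → m < n → ¬ Arrows k m)

{-# OPTIONS --safe #-}
-- Upper bound. By Gallai's theorem a rainbow-triangle-free colouring has a partition into modules with at
-- most two colours between them. Let F be a set of colours in which W₅ is forbidden and D one in which C₄
-- is forbidden, and let the remaining colours together form a matching. By induction on the number n of
-- vertices, n + |D| ≤ bound (|F| + |D|), where bound k = 2, 4, 14, 28, 70, … . Since W₅ = K₁ ∨ C₄ = P₃ ∨ 2K₁,
-- a vertex joined in one colour to a module moves that colour from F to D (or from D to the matching) inside
-- the module, and two such vertices move it from F to the matching. If some module X has at least two
-- vertices, its neighbourhoods in the two colours have at most twice the bound for |F| + |D| − 2 each, which
-- gives the factor 5; if all modules are single vertices, the colouring has two colours and the claim is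
-- R(W₅, W₅) ≤ 15.
--
-- R(W₅, W₅) ≤ 15. One of 15 vertices has, say, seven red neighbours, which induce one of eight 2-coloured
-- graphs. From each of these a search adds further vertices one at a time, keeping the list of colour
-- vectors that a remaining vertex can have towards the placed ones without closing a W₅. The vertices are
-- added in the order of this list, so that permuting them does not multiply the search.
--
-- Lower bound. A circulant colouring of K₁₄, joined to a copy of itself in a third colour when k is odd, is
-- substituted repeatedly for the vertices of the 2-coloured K₅ without a monochromatic triangle.
module Submission where

open import Defs hiding (sym)
open import Data.Bool using (Bool; true; false; _∧_; _∨_; if_then_else_)
open import Data.Bool.ListAction using (any)
open import Data.Empty using (⊥; ⊥-elim)
open import Data.Fin using (Fin; zero; suc; toℕ)
import Data.Fin as Fin hiding (_≟_)
import Data.Fin.Properties as Fin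
open import Data.List using (List; []; _∷_; map; zipWith; filter; length; lookup; allFin)
import Data.List.Properties as List
open import Data.List.Membership.Propositional using (_∈_; _∉_; find; lose)
open import Data.List.Membership.Propositional.Properties using (∈-map⁺; ∈-map⁻; ∈-filter⁻; ∈-filter⁺; ∈-lookup; ∈-allFin)
open import Data.List.Relation.Unary.All using (All; []; _∷_)
import Data.List.Relation.Unary.All as All
open import Data.List.Relation.Unary.AllPairs using ([]; _∷_)
open import Data.List.Relation.Unary.Any using (Any; here; there; any?)
open import Data.List.Relation.Unary.Unique.Propositional using (Unique)
import Data.List.Relation.Unary.Unique.Propositional.Properties as Unique
open import Data.Maybe using (Maybe; just; nothing)
open import Data.Nat using (ℕ; zero; suc; _+_; _*_; _^_; _≤_; _<_; z≤n; s≤s; ∣_-_∣)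
import Data.Nat as ℕ
open import Data.Nat.Properties hiding (_≟_)
open import Data.Product using (Σ; ∃; _×_; _,_; proj₁; proj₂)
open import Data.Sum using (_⊎_; inj₁; inj₂)
open import Data.Unit using (tt)
open import Function using (_∘_; case_of_)
open import Relation.Binary using (DecidableEquality)
open import Relation.Binary.PropositionalEquality using (_≡_; _≢_; refl; sym; trans; cong; cong₂; subst; subst₂; ≢-sym)
open import Relation.Nullary using (¬_; Dec; yes; no; ¬?; does)
open import Relation.Nullary.Decidable using (_×-dec_; _⊎-dec_; _→-dec_; decidable-stable; map′; toWitness; toWitnessFalse)

-- Lengths of filtered lists and Boolean tests.

module _ {A : Set} where

  remove-length : ∀ {P : A → Set} (P? : ∀ x → Dec (P x)) (xs : List A) → Unique xs →
    (∀ {x y} → x ∈ xs → y ∈ xs → ¬ P x → ¬ P y → x ≡ y) → length xs ≤ suc (length (filter P? xs))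
  remove-length P? [] _ _ = z≤n
  remove-length P? (x ∷ xs) (x∉ ∷ u) h with P? x
  ... | yes _ = s≤s (remove-length P? xs u λ p q → h (there p) (there q))
  ... | no ¬p = s≤s (≤-reflexive (cong length (sym (List.filter-all P? (All.tabulate all-P)))))
    where
    all-P : ∀ {y} → y ∈ xs → _
    all-P {y} y∈ with P? y
    ... | yes p = p
    ... | no ¬q = ⊥-elim (All.lookup x∉ y∈ (h (here refl) (there y∈) ¬p ¬q))

  filter-split : ∀ {P : A → Set} (P? : ∀ x → Dec (P x)) (xs : List A) →
    length (filter P? xs) + length (filter (λ x → ¬? (P? x)) xs) ≡ length xs
  filter-split P? [] = refl
  filter-split P? (x ∷ xs) with P? x
  ... | yes _ = cong suc (filter-split P? xs)
  ... | no _ = trans (+-suc _ _) (cong suc (filter-split P? xs))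

  filter-cover : ∀ {P Q : A → Set} (P? : ∀ x → Dec (P x)) (Q? : ∀ x → Dec (Q x)) (xs : List A) →
    (∀ {x} → x ∈ xs → P x ⊎ Q x) → length xs ≤ length (filter P? xs) + length (filter Q? xs)
  filter-cover P? Q? [] _ = z≤n
  filter-cover P? Q? (x ∷ xs) pq with ih ← filter-cover P? Q? xs (λ x∈ → pq (there x∈)) | P? x | Q? x
  ... | yes _ | yes _ = s≤s (≤-trans ih (+-monoʳ-≤ _ (n≤1+n _)))
  ... | yes _ | no _ = s≤s ih
  ... | no _ | yes _ = ≤-trans (s≤s ih) (≤-reflexive (sym (+-suc _ _)))
  ... | no ¬p | no ¬q = case pq (here refl) of λ { (inj₁ p) → ⊥-elim (¬p p) ; (inj₂ q) → ⊥-elim (¬q q) }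

  zipWith-map-map : ∀ {B C D : Set} (f : B → C → D) (g : A → B) (h : A → C) xs →
    zipWith f (map g xs) (map h xs) ≡ map (λ x → f (g x) (h x)) xs
  zipWith-map-map f g h [] = refl
  zipWith-map-map f g h (x ∷ xs) = cong (_ ∷_) (zipWith-map-map f g h xs)

  any-sound : ∀ (f : A → Bool) xs → any f xs ≡ true → ∃ λ x → x ∈ xs × f x ≡ true
  any-sound f (x ∷ xs) e with f x in eq
  ... | true  = x , here refl , eq
  ... | false = let y , y∈ , q = any-sound f xs e in y , there y∈ , q

∧-split : ∀ {x y} → x ∧ y ≡ true → x ≡ true × y ≡ true
∧-split {true} {true} refl = refl , refl

∨-split : ∀ {x y} → x ∨ y ≡ true → x ≡ true ⊎ y ≡ true
∨-split {true}  _ = inj₁ refl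
∨-split {false} e = inj₂ e

-- The Ramsey number of W₅

-- `none` is the colour on the diagonal.
data Hue : Set where
  none red blue : Hue

_≟ʰ_ : DecidableEquality Hue
none ≟ʰ none = yes refl
none ≟ʰ red = no λ ()
none ≟ʰ blue = no λ ()
red ≟ʰ none = no λ ()
red ≟ʰ red = yes refl
red ≟ʰ blue = no λ ()
blue ≟ʰ none = no λ ()
blue ≟ʰ red = no λ ()
blue ≟ʰ blue = yes refl

-- The search program.

Row Mat : Set
Row = List Hue
Mat = List Row

-- `none` matches nothing, itself included, so the diagonal of a matrix never counts as an edge.
is : Hue → Hue → Bool
is red red = true
is blue blue = true
is _ _ = false

is-sound : ∀ t x → is t x ≡ true → t ≢ none × x ≡ t
is-sound red red _ = (λ ()) , refl
is-sound blue blue _ = (λ ()) , refl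
is-sound red none ()
is-sound red blue ()
is-sound blue none ()
is-sound blue red ()
is-sound none _ ()

-- A row also serves as a set of placed vertices, those where it has the colour t. Applied
-- entrywise, these two are intersection and union, and the result is again a row that `meets`
-- accepts.
both either : Hue → Hue → Hue → Hue
both t x y = if is t x then (if is t y then t else none) else none
either t x y = if is t x then t else (if is t y then t else none)

both-sound : ∀ t x y → t ≢ none → both t x y ≡ t → x ≡ t × y ≡ t
both-sound t x y t≢ e with is t x in p | is t y in q
... | true  | true  = proj₂ (is-sound t x p) , proj₂ (is-sound t y q)
... | true  | false = ⊥-elim (t≢ (sym e))
... | false | _     = ⊥-elim (t≢ (sym e))

either-sound : ∀ t x y → t ≢ none → either t x y ≡ t → x ≡ t ⊎ y ≡ t
either-sound t x y t≢ e with is t x in p | is t y in q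
... | true  | _     = inj₁ (proj₂ (is-sound t x p))
... | false | true  = inj₂ (proj₂ (is-sound t y q))
... | false | false = ⊥-elim (t≢ (sym e))

meets meets₂ : Hue → Row → Row → Bool
meets t (x ∷ xs) (y ∷ ys) = (if is t x then is t y else false) ∨ meets t xs ys
meets t _ _ = false
meets₂ t (x ∷ xs) (y ∷ ys) =
  if (if is t x then is t y else false) then meets t xs ys else meets₂ t xs ys
meets₂ t _ _ = false

select : {A : Set} → Hue → Row → List A → List A
select t (x ∷ xs) (a ∷ as) = if is t x then a ∷ select t xs as else select t xs as
select t _ _ = []

-- In the next two tests u and x are two vertices outside the graph with matrix M, and U, X
-- their rows. `opposite` looks for a W₅ of colour t in which u and x are opposite on the rim,
-- `adjacent` for one in which they are adjacent by an edge of colour t.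

opposite adjacent : Hue → Mat → Row → Row → Bool
-- The hub is a common t-neighbour of u and x; two more common t-neighbours, both joined to the hub,
-- complete the rim.
opposite t M U X = let C = zipWith (both t) U X in any (meets₂ t C) (select t C M)

pairs : Hue → Row → Mat → Bool
pairs t Y [] = false
pairs t Y (m ∷ ms) = (let Z = zipWith (both t) Y m in any (meets t Z) ms) ∨ pairs t Y ms

adjacent t M U X = let C = select t (zipWith (both t) U X) M in
  -- The edge ux as a spoke: the hub is u or x, two common neighbours are opposite on the rim, and
  -- the last rim vertex is joined to both of them and to the hub.
  pairs t (zipWith (either t) U X) C
  -- The edge ux on the rim: the hub h is a common neighbour, and the rim is closed by a neighbour
  -- of x and h and a neighbour of u and h that are adjacent to each other.
  ∨ any (λ h → any (meets t (zipWith (both t) U h)) (select t (zipWith (both t) X h) M)) C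

extend : Mat → Row → List Row → List Row
extend M U [] = []
extend M U (X ∷ Cs) =
  -- A wheel with u and x opposite on the rim does not use the edge ux, so this test comes before
  -- the colour of that edge is chosen.
  if opposite red M U X ∨ opposite blue M U X then extend M U Cs
  else add red (add blue (extend M U Cs))
  where
  add : Hue → List Row → List Row
  add t Ds = if adjacent t M U X then Ds else (t ∷ X) ∷ Ds

grow : Mat → Row → Mat
grow M c = (none ∷ c) ∷ zipWith _∷_ c M

-- The answer `true` means refuted; n counts vertices that are still available. Either some
-- remaining vertex has the vector c and is placed, where c stays in the list because other vertices
-- may share it, or none has it and c is discarded for good.
search : ℕ → Mat → List Row → Bool
search zero M Cs = false
search (suc n) M [] = true
search (suc n) M (c ∷ Cs) = search n (grow M c) (extend M c (c ∷ Cs)) ∧ search (suc n) M Cs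

-- The vertices of a known graph T are placed first, without branching.
searchFrom : List Row → ℕ → Mat → List Row → Bool
searchFrom [] n M Cs = search n M Cs
searchFrom (c ∷ T) n M Cs = searchFrom T n (grow M c) (extend M c Cs)

-- Because it is built on `is`, a row containing `none` equals nothing. A successful comparison
-- therefore also shows that the vertex differs from those embedded before it.
_==_ : Row → Row → Bool
[] == [] = true
(x ∷ xs) == (y ∷ ys) = is x y ∧ (xs == ys)
_ == _ = false

-- Backtracking search for an induced copy of T in the graph M. The list L holds, for every vertex
-- of M, its colours towards the images chosen so far, latest first.
embed : List Row → Mat → Mat → Bool
place : Row → List Row → Mat → Mat → Mat → Mat → Bool
embed [] M L = true
embed (c ∷ T) M L = place c T M L M L
place c T M L (m ∷ ms) (l ∷ ls) =
  ((l == c) ∧ embed T M (zipWith _∷_ m L)) ∨ place c T M L ms ls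
place c T M L _ _ = false

-- The branching is that of `search`, but a branch that survives until p vertices are placed must
-- contain a copy of one of the graphs `Ts`.
classify : List (List Row) → ℕ → Mat → List Row → Bool
classify Ts zero M _ = any (λ T → embed T M (map (λ _ → []) M)) Ts
classify Ts (suc p) M [] = true
classify Ts (suc p) M (c ∷ Cs) =
  classify Ts p (grow M c) (extend M c (c ∷ Cs)) ∧ classify Ts (suc p) M Cs

-- Adjacent vertices differ because the diagonal is `none`, so `no-W5` asks for distinctness only of
-- opposite rim vertices.
record TwoColouring (V : Set) : Set where
  field
    χ      : V → V → Hue
    χ-sym  : ∀ x y → χ x y ≡ χ y x
    χ-diag : ∀ x → χ x x ≡ none
    χ-none : ∀ {x y} → χ x y ≡ none → x ≡ y
    no-W5  : ∀ {t h a p c q} → t ≢ none →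
             χ h a ≡ t → χ h p ≡ t → χ h c ≡ t → χ h q ≡ t →
             χ a p ≡ t → χ p c ≡ t → χ c q ≡ t → χ q a ≡ t → a ≢ c → p ≢ q → ⊥

-- Soundness of the search.

module Search {V : Set} (G : TwoColouring V) where
  open TwoColouring G

  _≟_ : DecidableEquality V
  x ≟ y with χ x y ≟ʰ none
  ... | yes e = yes (χ-none e)
  ... | no ¬e = no λ { refl → ¬e (χ-diag x) }

  flip : ∀ {x y t} → χ x y ≡ t → χ y x ≡ t
  flip {x} {y} e = trans (χ-sym y x) e

  row : List V → V → Row
  row ws x = map (χ x) ws

  mat : List V → Mat
  mat ws = map (row ws) ws

  meets-sound : ∀ t (f g : V → Hue) ws → meets t (map f ws) (map g ws) ≡ true →
    t ≢ none × ∃ λ w → w ∈ ws × f w ≡ t × g w ≡ t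
  meets-sound t f g (w ∷ ws) e with is t (f w) in p | is t (g w) in q
  ... | true | true = proj₁ (is-sound t _ p) , w , here refl , proj₂ (is-sound t _ p) , proj₂ (is-sound t _ q)
  ... | true | false = let a , w , w∈ , r = meets-sound t f g ws e in a , w , there w∈ , r
  ... | false | _ = let a , w , w∈ , r = meets-sound t f g ws e in a , w , there w∈ , r

  meets₂-sound : ∀ t (f g : V → Hue) ws → Unique ws → meets₂ t (map f ws) (map g ws) ≡ true →
    t ≢ none × ∃ λ p → ∃ λ q → p ≢ q × (p ∈ ws × f p ≡ t × g p ≡ t) × (q ∈ ws × f q ≡ t × g q ≡ t)
  meets₂-sound t f g (w ∷ ws) (w∉ ∷ u) e with is t (f w) in p | is t (g w) in q
  ... | true | true =
    let t≢ , v , v∈ , r = meets-sound t f g ws e in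
    t≢ , w , v , All.lookup w∉ v∈ ,
    (here refl , proj₂ (is-sound t _ p) , proj₂ (is-sound t _ q)) , (there v∈ , r)
  ... | true | false =
    let t≢ , v , w , n , (v∈ , r) , (w∈ , s) = meets₂-sound t f g ws u e in
    t≢ , v , w , n , (there v∈ , r) , (there w∈ , s)
  ... | false | _ =
    let t≢ , v , w , n , (v∈ , r) , (w∈ , s) = meets₂-sound t f g ws u e in
    t≢ , v , w , n , (there v∈ , r) , (there w∈ , s)

  select-map : ∀ {B : Set} t xs (ρ : V → B) ws → select t xs (map ρ ws) ≡ map ρ (select t xs ws)
  select-map t [] ρ ws = refl
  select-map t (x ∷ xs) ρ [] = refl
  select-map t (x ∷ xs) ρ (w ∷ ws) with is t x
  ... | true = cong (ρ w ∷_) (select-map t xs ρ ws)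
  ... | false = select-map t xs ρ ws

  ∈-select : ∀ t (f : V → Hue) ws {w} → w ∈ select t (map f ws) ws → w ∈ ws × t ≢ none × f w ≡ t
  ∈-select t f (v ∷ ws) w∈ with is t (f v) in p
  ∈-select t f (v ∷ ws) (here refl) | true = here refl , is-sound t _ p
  ∈-select t f (v ∷ ws) (there w∈) | true = let a , r = ∈-select t f ws w∈ in there a , r
  ... | false = let a , r = ∈-select t f ws w∈ in there a , r

  select-unique : ∀ t (f : V → Hue) ws → Unique ws → Unique (select t (map f ws) ws)
  select-unique t f [] _ = []
  select-unique t f (v ∷ ws) (v∉ ∷ u) with is t (f v)
  ... | true = All.tabulate (λ w∈ → All.lookup v∉ (proj₁ (∈-select t f ws w∈))) ∷ select-unique t f ws u
  ... | false = select-unique t f ws u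

  any-select : ∀ t (f : V → Hue) (φ : Row → Bool) (ρ : V → Row) ws →
    any φ (select t (map f ws) (map ρ ws)) ≡ true →
    ∃ λ w → w ∈ ws × t ≢ none × f w ≡ t × φ (ρ w) ≡ true
  any-select t f φ ρ ws e rewrite select-map t (map f ws) ρ ws
    with m , m∈ , q ← any-sound φ _ e
    with w , w∈ , refl ← ∈-map⁻ ρ m∈ = let a , t≢ , c = ∈-select t f ws w∈ in w , a , t≢ , c , q

  pairs-sound : ∀ t ws vs (f : V → Hue) → Unique vs → pairs t (map f ws) (map (row ws) vs) ≡ true →
    ∃ λ p → ∃ λ q → p ∈ vs × q ∈ vs × p ≢ q × t ≢ none ×
    ∃ λ w → w ∈ ws × f w ≡ t × χ p w ≡ t × χ q w ≡ t
  pairs-sound t ws (p ∷ vs) f (p∉ ∷ u) e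
    with ∨-split {any (meets t (zipWith (both t) (map f ws) (row ws p))) (map (row ws) vs)} e
  ... | inj₂ e′ = let a , b , a∈ , b∈ , r = pairs-sound t ws vs f u e′ in a , b , there a∈ , there b∈ , r
  ... | inj₁ e′ with any-sound _ (map (row ws) vs) e′
  ... | m , m∈ , e″ with ∈-map⁻ (row ws) m∈
  ... | q , q∈ , refl rewrite zipWith-map-map (both t) f (χ p) ws =
    let t≢ , w , w∈ , fw , qw = meets-sound t (λ w → both t (f w) (χ p w)) (χ q) ws e″
        fw′ , pw = both-sound t _ _ t≢ fw
    in p , q , here refl , there q∈ , All.lookup p∉ q∈ , t≢ , w , w∈ , fw′ , pw , qw

  module _ (ws : List V) (ws! : Unique ws) (u x : V) (u∉ : u ∉ ws) (x∉ : x ∉ ws) (u≢x : u ≢ x) where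

    opposite-sound : ∀ t → opposite t (mat ws) (row ws u) (row ws x) ≡ true → ⊥
    opposite-sound t e rewrite zipWith-map-map (both t) (χ u) (χ x) ws =
      let C = λ w → both t (χ u w) (χ x w)
          h , h∈ , t≢ , ch , e₁ = any-select t C (meets₂ t (map C ws)) (row ws) ws e
          _ , p , q , p≢q , (_ , cp , hp) , (_ , cq , hq) = meets₂-sound t C (χ h) ws ws! e₁
          uh , xh = both-sound t _ _ t≢ ch
          up , xp = both-sound t _ _ t≢ cp
          uq , xq = both-sound t _ _ t≢ cq
      in no-W5 t≢ (flip uh) hp (flip xh) hq up (flip xp) xq (flip uq) u≢x p≢q

    ∉⇒≢ : ∀ {y w} → y ∉ ws → w ∈ ws → y ≢ w
    ∉⇒≢ y∉ w∈ refl = y∉ w∈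

    adjacent-sound : ∀ t → χ u x ≡ t → adjacent t (mat ws) (row ws u) (row ws x) ≡ true → ⊥
    adjacent-sound t ux e
      rewrite zipWith-map-map (both t) (χ u) (χ x) ws
            | zipWith-map-map (either t) (χ u) (χ x) ws
      with ∨-split {pairs t (map (λ w → either t (χ u w) (χ x w)) ws)
                     (select t (map (λ w → both t (χ u w) (χ x w)) ws) (mat ws))} e
    ... | inj₁ e₁ rewrite select-map t (map (λ w → both t (χ u w) (χ x w)) ws) (row ws) ws
      with pairs-sound t ws _ (λ w → either t (χ u w) (χ x w)) (select-unique t _ ws ws!) e₁
    ... | p , q , p∈ , q∈ , p≢q , t≢ , w , w∈ , ew , pw , qw
      with both-sound t _ _ t≢ (proj₂ (proj₂ (∈-select t _ ws p∈)))
         | both-sound t _ _ t≢ (proj₂ (proj₂ (∈-select t _ ws q∈)))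
         | either-sound t _ _ t≢ ew
    ... | up , xp | uq , xq | inj₁ uw =
      no-W5 t≢ ux up uw uq xp pw (flip qw) (flip xq) (∉⇒≢ x∉ w∈) p≢q
    ... | up , xp | uq , xq | inj₂ xw =
      no-W5 t≢ (flip ux) xp xw xq up pw (flip qw) (flip uq) (∉⇒≢ u∉ w∈) p≢q
    adjacent-sound t ux e | inj₂ e₁
      with any-select t (λ w → both t (χ u w) (χ x w))
             (λ h → any (meets t (zipWith (both t) (row ws u) h)) (select t (zipWith (both t) (row ws x) h) (mat ws)))
             (row ws) ws e₁
    ... | h , h∈ , t≢ , ch , e₂
      rewrite zipWith-map-map (both t) (χ u) (χ h) ws
            | zipWith-map-map (both t) (χ x) (χ h) ws
      with any-select t (λ w → both t (χ x w) (χ h w)) (meets t (map (λ w → both t (χ u w) (χ h w)) ws)) (row ws) ws e₂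
    ... | s , s∈ , _ , cs , e₃
      with meets-sound t (λ w → both t (χ u w) (χ h w)) (χ s) ws e₃
    ... | _ , w , w∈ , cw , sw
      with both-sound t _ _ t≢ ch | both-sound t _ _ t≢ cs | both-sound t _ _ t≢ cw
    ... | uh , xh | xs , hs | uw , hw =
      no-W5 t≢ (flip xh) (flip uh) hw hs (flip ux) uw (flip sw) (flip xs) (∉⇒≢ x∉ w∈) (∉⇒≢ u∉ s∈)

    -- A vector is discarded only if it would close a wheel, so the actual vector of a remaining
    -- vertex always survives.
    extend-sound : ∀ Cs → row ws x ∈ Cs → row (u ∷ ws) x ∈ extend (mat ws) (row ws u) Cs
    extend-sound (C ∷ Cs) (there r∈)
      with opposite red (mat ws) (row ws u) C ∨ opposite blue (mat ws) (row ws u) C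
    ... | true = extend-sound Cs r∈
    ... | false with adjacent red (mat ws) (row ws u) C | adjacent blue (mat ws) (row ws u) C
    ... | true  | true  = extend-sound Cs r∈
    ... | true  | false = there (extend-sound Cs r∈)
    ... | false | true  = there (extend-sound Cs r∈)
    ... | false | false = there (there (extend-sound Cs r∈))
    extend-sound (_ ∷ Cs) (here refl)
      with opposite red (mat ws) (row ws u) (row ws x) ∨ opposite blue (mat ws) (row ws u) (row ws x) in e
    ... | true = ⊥-elim (case ∨-split e of λ { (inj₁ p) → opposite-sound red p ; (inj₂ p) → opposite-sound blue p })
    ... | false
      with adjacent red (mat ws) (row ws u) (row ws x) in er | adjacent blue (mat ws) (row ws u) (row ws x) in eb | χ x u in ex
    ... | _ | _ | none = ⊥-elim (u≢x (sym (χ-none ex)))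
    ... | true  | _ | red = ⊥-elim (adjacent-sound red (flip ex) er)
    ... | false | _ | red = here refl
    ... | _     | true  | blue = ⊥-elim (adjacent-sound blue (flip ex) eb)
    ... | true  | false | blue = here refl
    ... | false | false | blue = there (here refl)

  grow-mat : ∀ ws u → grow (mat ws) (row ws u) ≡ mat (u ∷ ws)
  grow-mat ws u = cong₂ _∷_ (cong (_∷ row ws u) (sym (χ-diag u)))
    (trans (zipWith-map-map _∷_ (χ u) (row ws) ws) (List.map-cong (λ w → cong (_∷ row ws w) (χ-sym u w)) ws))

  _≟ʳ_ : DecidableEquality Row
  _≟ʳ_ = List.≡-dec _≟ʰ_

  remove : V → List V → List V
  remove u = filter (λ y → ¬? (u ≟ y))

  length-remove : ∀ u {R} → Unique R → length R ≤ suc (length (remove u R))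
  length-remove u {R} R! = remove-length (λ y → ¬? (u ≟ y)) R R!
    λ {x} {y} _ _ p q → trans (sym (unnot p)) (unnot q)
    where
    unnot : ∀ {y} → ¬ ¬ u ≡ y → u ≡ y
    unnot {y} ¬¬p with u ≟ y
    ... | yes p = p
    ... | no ¬p = ⊥-elim (¬¬p ¬p)

  -- ws are the vertices placed so far, R the vertices still to be placed.
  record Open (ws : List V) (Cs : List Row) (R : List V) : Set where
    field
      ws!  : Unique ws
      R!   : Unique R
      rows : ∀ {x} → x ∈ R → x ∉ ws × row ws x ∈ Cs
  open Open

  pick : ∀ {ws Cs R} u → u ∉ ws → Open ws Cs R →
    Open (u ∷ ws) (extend (mat ws) (row ws u) Cs) (remove u R)
  pick {ws} {Cs} {R} u u∉ O = record
    { ws! = All.tabulate (λ { w∈ refl → u∉ w∈ }) ∷ ws! O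
    ; R!  = Unique.filter⁺ _ (R! O)
    ; rows = λ {x} x∈ →
        let x∈R , u≢x = ∈-filter⁻ (λ y → ¬? (u ≟ y)) x∈
            x∉ , r∈ = rows O x∈R
        in (λ { (here refl) → u≢x refl ; (there p) → x∉ p })
           , extend-sound ws (ws! O) u x u∉ x∉ u≢x Cs r∈
    }

  skip : ∀ {ws c Cs R} → (∀ {x} → x ∈ R → row ws x ≢ c) → Open ws (c ∷ Cs) R → Open ws Cs R
  skip ne O = record { ws! = ws! O ; R! = R! O ; rows = λ x∈ → case rows O x∈ of λ
    { (x∉ , here e) → ⊥-elim (ne x∈ e) ; (x∉ , there r∈) → x∉ , r∈ } }

  step-or-skip : ∀ {ws c Cs R} → Open ws (c ∷ Cs) R →
    (∃ λ u → u ∈ R × row ws u ≡ c) ⊎ Open ws Cs R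
  step-or-skip {ws} {c} {R = R} O with any? (λ u → row ws u ≟ʳ c) R
  ... | yes p = inj₁ (find p)
  ... | no ¬p = inj₂ (skip (λ x∈ e → ¬p (lose x∈ e)) O)

  search-sound : ∀ n ws Cs R → Open ws Cs R → n ≤ length R → search n (mat ws) Cs ≡ true → ⊥
  search-sound (suc n) ws = go
    where
    go : ∀ Cs R → Open ws Cs R → suc n ≤ length R → search (suc n) (mat ws) Cs ≡ true → ⊥
    go [] (x ∷ R) O _ _ with () ← proj₂ (rows O (here refl))
    go (c ∷ Cs) R O n≤ e with step-or-skip O
    ... | inj₂ O′ = go Cs R O′ n≤ (proj₂ (∧-split e))
    ... | inj₁ (u , u∈ , refl) =
      search-sound n (u ∷ ws) Ds (remove u R) (pick u (proj₁ (rows O u∈)) O)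
        (≤-pred (≤-trans n≤ (length-remove u (R! O))))
        (subst (λ M → search n M Ds ≡ true) (grow-mat ws u) (proj₁ (∧-split e)))
      where Ds = extend (mat ws) (row ws u) (row ws u ∷ Cs)

  -- As every row records the colours to all earlier vertices, this is an induced copy of the listed
  -- graph, on distinct vertices outside `ws`.
  data Realises (ws : List V) : List Row → Set where
    []   : Realises ws []
    _∷_ : ∀ {w T} → w ∉ ws → Realises (w ∷ ws) T → Realises ws (row ws w ∷ T)

  searchFrom-sound : ∀ T n ws Cs R → Realises ws T → Open ws Cs R → length T + n ≤ length R →
    searchFrom T n (mat ws) Cs ≡ true → ⊥
  searchFrom-sound [] n ws Cs R [] O n≤ e = search-sound n ws Cs R O n≤ e
  searchFrom-sound (_ ∷ T) n ws Cs R (_∷_ {w} w∉ ρ) O n≤ e =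
    -- The vertex w need not belong to R; in either case its removal costs at most one vertex.
    searchFrom-sound T n (w ∷ ws) _ (remove w R) ρ (pick w w∉ O)
      (≤-pred (≤-trans n≤ (length-remove w (R! O))))
      (subst (λ M → searchFrom T n M (extend (mat ws) (row ws w) Cs) ≡ true) (grow-mat ws w) e)

  ==-sound : ∀ l c → (l == c) ≡ true → l ≡ c × none ∉ l
  ==-sound [] [] _ = refl , λ ()
  ==-sound (x ∷ l) (y ∷ c) e =
    let e₁ , e₂ = ∧-split e
        x≢ , y≡ = is-sound x y e₁
        l≡ , n∉ = ==-sound l c e₂
    in cong₂ _∷_ (sym y≡) l≡ , λ { (here p) → x≢ (sym p) ; (there p) → n∉ p }

  row-∌ : ∀ {ws w} → none ∉ row ws w → w ∉ ws
  row-∌ {ws} {w} n∉ w∈ = n∉ (subst (_∈ row ws w) (χ-diag w) (∈-map⁺ (χ w) w∈))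

  embed-sound : ∀ T ws js → embed T (mat ws) (map (row js) ws) ≡ true → Realises js T
  place-sound : ∀ c T ws js vs →
    place c T (mat ws) (map (row js) ws) (map (row ws) vs) (map (row js) vs) ≡ true → Realises js (c ∷ T)
  embed-sound [] ws js e = []
  embed-sound (c ∷ T) ws js e = place-sound c T ws js ws e
  place-sound c T ws js (v ∷ vs) e with ∨-split {(row js v == c) ∧ _} e
  ... | inj₂ e′ = place-sound c T ws js vs e′
  ... | inj₁ e′ with ∧-split {row js v == c} e′
  ... | e₁ , e₂ with ==-sound (row js v) c e₁
  ... | refl , n∉ = row-∌ n∉ ∷ embed-sound T ws (v ∷ js)
    (subst (λ L → embed T (mat ws) L ≡ true)
      (trans (zipWith-map-map _∷_ (χ v) (row js) ws) (List.map-cong (λ w → cong (_∷ row js w) (χ-sym v w)) ws)) e₂)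

  classify-sound : ∀ Ts p ws Cs R → Open ws Cs R → p ≤ length R → classify Ts p (mat ws) Cs ≡ true →
    ∃ λ T → T ∈ Ts × Realises [] T
  classify-sound Ts zero ws Cs R O _ e =
    let T , T∈ , e′ = any-sound _ Ts e in
    T , T∈ , embed-sound T ws [] (subst (λ L → embed T (mat ws) L ≡ true) (sym (List.map-∘ ws)) e′)
  classify-sound Ts (suc p) ws = go
    where
    go : ∀ Cs R → Open ws Cs R → suc p ≤ length R → classify Ts (suc p) (mat ws) Cs ≡ true →
      ∃ λ T → T ∈ Ts × Realises [] T
    go [] (x ∷ R) O _ _ with () ← proj₂ (rows O (here refl))
    go (c ∷ Cs) R O p≤ e with step-or-skip O
    ... | inj₂ O′ = go Cs R O′ p≤ (proj₂ (∧-split e))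
    ... | inj₁ (u , u∈ , refl) =
      classify-sound Ts p (u ∷ ws) Ds (remove u R) (pick u (proj₁ (rows O u∈)) O)
        (≤-pred (≤-trans p≤ (length-remove u (R! O))))
        (subst (λ M → classify Ts p M Ds ≡ true) (grow-mat ws u) (proj₁ (∧-split e)))
      where Ds = extend (mat ws) (row ws u) (row ws u ∷ Cs)

-- The seven red neighbours of a vertex v induce a C₄-free red graph with W₅-free complement; these are all such
-- graphs up to isomorphism, preceded by v. A graph is given by the rows of its vertices, each row listing
-- the colours to the preceding vertices, latest first.
neighbourhoods : List (List Row)
neighbourhoods =
  ([] ∷ (red ∷ [])
   ∷ (red ∷ red ∷ [])
   ∷ (blue ∷ blue ∷ red ∷ [])
   ∷ (blue ∷ blue ∷ red ∷ red ∷ [])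
   ∷ (blue ∷ red ∷ red ∷ red ∷ red ∷ [])
   ∷ (red ∷ blue ∷ red ∷ blue ∷ blue ∷ red ∷ [])
   ∷ (red ∷ blue ∷ red ∷ blue ∷ blue ∷ blue ∷ red ∷ []) ∷ [])
  ∷ ([] ∷ (red ∷ [])
   ∷ (blue ∷ red ∷ [])
   ∷ (red ∷ blue ∷ red ∷ [])
   ∷ (red ∷ red ∷ blue ∷ red ∷ [])
   ∷ (blue ∷ blue ∷ blue ∷ red ∷ red ∷ [])
   ∷ (red ∷ blue ∷ blue ∷ red ∷ red ∷ red ∷ [])
   ∷ (blue ∷ red ∷ red ∷ blue ∷ blue ∷ blue ∷ red ∷ []) ∷ [])
  ∷ ([] ∷ (red ∷ [])
   ∷ (red ∷ red ∷ [])
   ∷ (blue ∷ blue ∷ red ∷ [])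
   ∷ (blue ∷ blue ∷ red ∷ red ∷ [])
   ∷ (red ∷ blue ∷ blue ∷ blue ∷ red ∷ [])
   ∷ (blue ∷ red ∷ red ∷ blue ∷ red ∷ red ∷ [])
   ∷ (blue ∷ red ∷ blue ∷ red ∷ red ∷ blue ∷ red ∷ []) ∷ [])
  ∷ ([] ∷ (red ∷ [])
   ∷ (blue ∷ red ∷ [])
   ∷ (blue ∷ red ∷ red ∷ [])
   ∷ (blue ∷ blue ∷ blue ∷ red ∷ [])
   ∷ (red ∷ blue ∷ blue ∷ red ∷ red ∷ [])
   ∷ (red ∷ blue ∷ blue ∷ blue ∷ red ∷ red ∷ [])
   ∷ (blue ∷ blue ∷ blue ∷ red ∷ red ∷ red ∷ red ∷ []) ∷ [])
  ∷ ([] ∷ (red ∷ [])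
   ∷ (blue ∷ red ∷ [])
   ∷ (blue ∷ red ∷ red ∷ [])
   ∷ (blue ∷ blue ∷ blue ∷ red ∷ [])
   ∷ (red ∷ red ∷ blue ∷ red ∷ red ∷ [])
   ∷ (blue ∷ blue ∷ blue ∷ blue ∷ red ∷ red ∷ [])
   ∷ (red ∷ blue ∷ red ∷ blue ∷ red ∷ blue ∷ red ∷ []) ∷ [])
  ∷ ([] ∷ (red ∷ [])
   ∷ (blue ∷ red ∷ [])
   ∷ (red ∷ blue ∷ red ∷ [])
   ∷ (blue ∷ blue ∷ blue ∷ red ∷ [])
   ∷ (red ∷ red ∷ blue ∷ blue ∷ red ∷ [])
   ∷ (blue ∷ blue ∷ blue ∷ red ∷ red ∷ red ∷ [])
   ∷ (red ∷ blue ∷ red ∷ blue ∷ blue ∷ red ∷ red ∷ []) ∷ [])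
  ∷ ([] ∷ (red ∷ [])
   ∷ (blue ∷ red ∷ [])
   ∷ (blue ∷ red ∷ red ∷ [])
   ∷ (red ∷ blue ∷ blue ∷ red ∷ [])
   ∷ (red ∷ blue ∷ blue ∷ blue ∷ red ∷ [])
   ∷ (red ∷ blue ∷ blue ∷ blue ∷ red ∷ red ∷ [])
   ∷ (blue ∷ blue ∷ blue ∷ red ∷ red ∷ red ∷ red ∷ []) ∷ [])
  ∷ ([] ∷ (red ∷ [])
   ∷ (red ∷ red ∷ [])
   ∷ (blue ∷ blue ∷ red ∷ [])
   ∷ (red ∷ blue ∷ red ∷ red ∷ [])
   ∷ (blue ∷ blue ∷ blue ∷ blue ∷ red ∷ [])
   ∷ (red ∷ blue ∷ red ∷ blue ∷ blue ∷ red ∷ [])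
   ∷ (blue ∷ red ∷ blue ∷ blue ∷ red ∷ blue ∷ red ∷ []) ∷ []) ∷ []

-- The start is the single vertex v, and red is the only colour allowed towards it, so the seven
-- vertices placed are red neighbours of v.
neighbourhoods-complete : classify neighbourhoods 7 ((none ∷ []) ∷ []) ((red ∷ []) ∷ []) ≡ true
neighbourhoods-complete = refl

-- Eight vertices of the list entry and seven further ones make 15. Before anything is placed, every
-- vertex has the empty row.
neighbourhoods-closed : All (λ T → length T ≡ 8 × searchFrom T 7 [] ([] ∷ []) ≡ true) neighbourhoods
neighbourhoods-closed = (refl , refl) ∷ (refl , refl) ∷ (refl , refl) ∷ (refl , refl)
  ∷ (refl , refl) ∷ (refl , refl) ∷ (refl , refl) ∷ (refl , refl) ∷ []

module _ {V : Set} (G : TwoColouring V) where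
  open TwoColouring G
  open Search G

  -- The classification of R together with v yields an induced copy of a graph on the list. The
  -- search then starts afresh from this copy, with all of `xs` to draw on.
  red-degree<7 : ∀ {xs v R} → Unique xs → 15 ≤ length xs → Unique R → 7 ≤ length R →
    (∀ {x} → x ∈ R → x ≢ v × χ v x ≡ red) → ⊥
  red-degree<7 {xs} {v} {R} xs! 15≤ R! 7≤ reds
    with T , T∈ , ρ ← classify-sound neighbourhoods 7 (v ∷ []) ((red ∷ []) ∷ []) R
      record { ws! = [] ∷ [] ; R! = R! ; rows = λ x∈ → let x≢v , e = reds x∈ in
        (λ { (here p) → x≢v p }) , here (cong (_∷ []) (flip e)) }
      7≤ (subst (λ d → classify neighbourhoods 7 ((d ∷ []) ∷ []) ((red ∷ []) ∷ []) ≡ true) (sym (χ-diag v)) neighbourhoods-complete)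
    with |T|≡8 , closed ← All.lookup neighbourhoods-closed T∈ =
    searchFrom-sound T 7 [] ([] ∷ []) xs ρ
      record { ws! = [] ; R! = xs! ; rows = λ _ → (λ ()) , here refl }
      (subst (λ n → n + 7 ≤ length xs) (sym |T|≡8) 15≤) closed

swap : Hue → Hue
swap none = none
swap red = blue
swap blue = red

swap-swap : ∀ t → swap (swap t) ≡ t
swap-swap none = refl
swap-swap red = refl
swap-swap blue = refl

recolour : ∀ {V} → TwoColouring V → TwoColouring V
recolour G = record
  { χ = λ x y → swap (χ x y)
  ; χ-sym = λ x y → cong swap (χ-sym x y)
  ; χ-diag = λ x → cong swap (χ-diag x)
  ; χ-none = λ e → χ-none (back e)
  ; no-W5 = λ t≢ a b c d e f g h → no-W5 (λ p → t≢ (trans (sym (swap-swap _)) (cong swap p)))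
      (back a) (back b) (back c) (back d) (back e) (back f) (back g) (back h)
  }
  where
  open TwoColouring G
  back : ∀ {s t} → swap s ≡ t → s ≡ swap t
  back {s} refl = sym (swap-swap s)

-- Among 14 vertices other than v, seven are joined to v in the same colour; if that is blue, the
-- colours are swapped.
ramsey : ∀ {V} (G : TwoColouring V) (xs : List V) → Unique xs → 15 ≤ length xs → ⊥
ramsey G [] _ ()
ramsey G xs@(v ∷ R) xs!@(v∉ ∷ R!) 15≤ = by-red-degree (7 ≤? length (filter red? R))
  where
  open TwoColouring G
  red? : ∀ x → Dec (χ v x ≡ red)
  red? x = χ v x ≟ʰ red

  swapped : ∀ {x} → v ≢ x → χ v x ≢ red → swap (χ v x) ≡ red
  swapped {x} v≢x ne with χ v x in e
  ... | none = ⊥-elim (v≢x (χ-none e))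
  ... | red = ⊥-elim (ne refl)
  ... | blue = refl

  by-red-degree : Dec (7 ≤ length (filter red? R)) → ⊥
  by-red-degree (yes 7≤) = red-degree<7 G xs! 15≤ (Unique.filter⁺ red? R!) 7≤
    λ x∈ → let x∈R , e = ∈-filter⁻ red? x∈ in (λ p → All.lookup v∉ x∈R (sym p)) , e
  by-red-degree (no 7≰) =
    red-degree<7 (recolour G) xs! 15≤ (Unique.filter⁺ (λ x → ¬? (red? x)) R!)
      (+-cancelˡ-≤ 7 7 _ (≤-trans (≤-pred 15≤) (≤-trans (≤-reflexive (sym (filter-split red? R)))
        (+-monoˡ-≤ _ (≤-trans (n≤1+n _) (≰⇒> 7≰))))))
      λ x∈ → let x∈R , ne = ∈-filter⁻ (λ x → ¬? (red? x)) x∈ in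
        (λ p → All.lookup v∉ x∈R (sym p)) , swapped (All.lookup v∉ x∈R) ne

-- Two-coloured graphs with colours that contain no C₄.

NoC4ʰ : ∀ {V} → TwoColouring V → Hue → Set
NoC4ʰ G t = ∀ {a p c q} → χ a p ≡ t → χ p c ≡ t → χ c q ≡ t → χ q a ≡ t → a ≢ c → p ≢ q → ⊥
  where
  open TwoColouring G

-- An apex joined to everything in red reduces a forbidden red C₄ to a forbidden red W₅. If the apex
-- is the hub of a red wheel, the rim is a red C₄; if it lies on the rim, the hub and the other
-- three rim vertices form a red C₄.
cone : ∀ {V} (G : TwoColouring V) → NoC4ʰ G red → TwoColouring (Maybe V)
cone {V} G noC4 = record
  { χ = χ⁺ ; χ-sym = sym⁺ ; χ-diag = diag⁺ ; χ-none = none⁺ ; no-W5 = λ {t} {h} → noW5⁺ t {h} }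
  where
  open TwoColouring G

  χ⁺ : Maybe V → Maybe V → Hue
  χ⁺ (just x) (just y) = χ x y
  χ⁺ nothing nothing = none
  χ⁺ _ _ = red

  sym⁺ : ∀ x y → χ⁺ x y ≡ χ⁺ y x
  sym⁺ (just x) (just y) = χ-sym x y
  sym⁺ (just x) nothing = refl
  sym⁺ nothing (just y) = refl
  sym⁺ nothing nothing = refl

  diag⁺ : ∀ x → χ⁺ x x ≡ none
  diag⁺ (just x) = χ-diag x
  diag⁺ nothing = refl

  none⁺ : ∀ {x y} → χ⁺ x y ≡ none → x ≡ y
  none⁺ {just x} {just y} e = cong just (χ-none e)
  none⁺ {nothing} {nothing} e = refl

  flip⁺ : ∀ {x y t} → χ x y ≡ t → χ y x ≡ t
  flip⁺ {x} {y} e = trans (χ-sym y x) e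

  red≢ : ∀ {x y} → χ x y ≡ red → x ≢ y
  red≢ {x} e refl with () ← trans (sym (χ-diag x)) e

  just≢ : ∀ {x y : V} → just x ≢ just y → x ≢ y
  just≢ ne e = ne (cong just e)

  noW5⁺ : ∀ t {h a p c q} → t ≢ none →
          χ⁺ h a ≡ t → χ⁺ h p ≡ t → χ⁺ h c ≡ t → χ⁺ h q ≡ t →
          χ⁺ a p ≡ t → χ⁺ p c ≡ t → χ⁺ c q ≡ t → χ⁺ q a ≡ t → a ≢ c → p ≢ q → ⊥
  noW5⁺ none t≢ _ _ _ _ _ _ _ _ _ _ = t≢ refl
  noW5⁺ t {just h} {just a} {just p} {just c} {just q} t≢ ha hp hc hq ap pc cq qa ac pq =
    no-W5 t≢ ha hp hc hq ap pc cq qa (just≢ ac) (just≢ pq)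
  noW5⁺ red {nothing} {just a} {just p} {just c} {just q} _ _ _ _ _ ap pc cq qa ac pq =
    noC4 ap pc cq qa (just≢ ac) (just≢ pq)
  noW5⁺ red {just h} {nothing} {just p} {just c} {just q} _ _ hp hc hq _ pc cq _ _ pq =
    noC4 hp pc cq (flip⁺ hq) (red≢ hc) (just≢ pq)
  noW5⁺ red {just h} {just a} {just p} {nothing} {just q} _ ha hp _ hq ap _ _ qa _ pq =
    noC4 hp (flip⁺ ap) (flip⁺ qa) (flip⁺ hq) (red≢ ha) (just≢ pq)
  noW5⁺ red {just h} {just a} {nothing} {just c} {just q} _ ha _ hc hq _ _ cq qa ac _ =
    noC4 ha (flip⁺ qa) (flip⁺ cq) (flip⁺ hc) (red≢ hq) (just≢ ac)
  noW5⁺ red {just h} {just a} {just p} {just c} {nothing} _ ha hp hc _ ap pc _ _ ac _ =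
    noC4 ha ap pc (flip⁺ hc) (red≢ hp) (just≢ ac)
  noW5⁺ red {nothing} {nothing} _ ()
  noW5⁺ red {nothing} {just _} {nothing} _ _ ()
  noW5⁺ red {nothing} {just _} {just _} {nothing} _ _ _ ()
  noW5⁺ red {nothing} {just _} {just _} {just _} {nothing} _ _ _ _ ()
  noW5⁺ red {just _} {nothing} {nothing} _ _ _ _ _ ()
  noW5⁺ red {just _} {nothing} {just _} {nothing} _ _ _ _ _ _ _ _ _ ac _ = ac refl
  noW5⁺ red {just _} {nothing} {just _} {just _} {nothing} _ _ _ _ _ _ _ _ () _ _
  noW5⁺ red {just _} {just _} {nothing} {nothing} _ _ _ _ _ _ () _ _ _ _
  noW5⁺ red {just _} {just _} {nothing} {just _} {nothing} _ _ _ _ _ _ _ _ _ _ pq = pq refl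
  noW5⁺ red {just _} {just _} {just _} {nothing} {nothing} _ _ _ _ _ _ _ () _ _ _
  noW5⁺ blue {nothing} {nothing} _ ()
  noW5⁺ blue {nothing} {just _} _ ()
  noW5⁺ blue {just _} {nothing} _ ()
  noW5⁺ blue {just _} {just _} {nothing} _ _ ()
  noW5⁺ blue {just _} {just _} {just _} {nothing} _ _ _ ()
  noW5⁺ blue {just _} {just _} {just _} {just _} {nothing} _ _ _ _ ()

-- The apex has no blue edge, so no blue C₄ arises. With the colours swapped, a second cone can be
-- taken over the first.
cone-blue : ∀ {V} (G : TwoColouring V) (noC4 : NoC4ʰ G red) → NoC4ʰ G blue → NoC4ʰ (recolour (cone G noC4)) red
cone-blue G _ noC4 {just a} {just p} {just c} {just q} ap pc cq qa ac pq =
  noC4 (unswap ap) (unswap pc) (unswap cq) (unswap qa) (λ e → ac (cong just e)) (λ e → pq (cong just e))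
  where
  unswap : ∀ {t} → swap t ≡ red → t ≡ blue
  unswap {blue} _ = refl
cone-blue G _ _ {nothing} {nothing} ()
cone-blue G _ _ {nothing} {just _} ()
cone-blue G _ _ {just _} {nothing} ()
cone-blue G _ _ {just _} {just _} {nothing} _ ()
cone-blue G _ _ {just _} {just _} {just _} {nothing} _ _ ()

nothing∷-unique : ∀ {V : Set} {xs : List V} → Unique xs → Unique (nothing ∷ map just xs)
nothing∷-unique {xs = xs} xs! =
  All.tabulate (λ { m∈ refl → case ∈-map⁻ just m∈ of λ { (_ , _ , ()) } })
  ∷ Unique.map⁺ (λ { refl → refl }) xs!

ramsey₁ : ∀ {V} (G : TwoColouring V) → NoC4ʰ G red → (xs : List V) → Unique xs → 14 ≤ length xs → ⊥
ramsey₁ G noC4 xs xs! 14≤ = ramsey (cone G noC4) (nothing ∷ map just xs) (nothing∷-unique xs!)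
  (s≤s (≤-trans 14≤ (≤-reflexive (sym (List.length-map just xs)))))

ramsey₂ : ∀ {V} (G : TwoColouring V) → NoC4ʰ G red → NoC4ʰ G blue →
  (xs : List V) → Unique xs → 13 ≤ length xs → ⊥
ramsey₂ G noC4r noC4b xs xs! 13≤ = ramsey₁ (recolour (cone G noC4r)) (cone-blue G noC4r noC4b)
  (nothing ∷ map just xs) (nothing∷-unique xs!)
  (s≤s (≤-trans 13≤ (≤-reflexive (sym (List.length-map just xs)))))

-- Gallai partitions

module _ {V : Set} (_≟_ : DecidableEquality V) where

  -- Connectedness of a class is expressed by induction along R-edges inside xs.
  record Components (R : V → V → Set) (xs : List V) : Set₁ where
    field
      class   : V → V
      class-∈ : ∀ {x} → x ∈ xs → class x ∈ xs
      edge    : ∀ {x y} → x ∈ xs → y ∈ xs → R x y → class x ≡ class y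
      connect : (Q : V → Set) → (∀ {x y} → x ∈ xs → y ∈ xs → R x y → Q x → Q y) →
                ∀ {x y} → x ∈ xs → y ∈ xs → class x ≡ class y → Q x → Q y

  module _ {R : V → V → Set} (R? : ∀ x y → Dec (R x y)) (R-sym : ∀ {x y} → R x y → R y x) where

    -- Vertices are added one at a time. The new vertex v represents the class formed by itself and
    -- all earlier components with an edge to v; the other classes stay as they are.
    components : ∀ xs → Unique xs → Components R xs
    components [] _ = record { class = λ x → x ; class-∈ = λ () ; edge = λ () ; connect = λ _ _ () }
    components (v ∷ xs) (v∉ ∷ xs!) = record
      { class = class′ ; class-∈ = class′-∈ ; edge = edge′ ; connect = connect′ }
      where
      open Components (components xs xs!)

      Touched : V → Set
      Touched l = ∃ λ d → d ∈ xs × class d ≡ l × R v d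

      touched? : ∀ l → Dec (Touched l)
      touched? l with any? (λ d → (class d ≟ l) ×-dec R? v d) xs
      ... | yes p = let d , d∈ , q = find p in yes (d , d∈ , q)
      ... | no ¬p = no λ (d , d∈ , q) → ¬p (lose d∈ q)

      class′ : V → V
      class′ x with x ≟ v | touched? (class x)
      ... | yes _ | _     = v
      ... | no _  | yes _ = v
      ... | no _  | no _  = class x

      class′-v : class′ v ≡ v
      class′-v with v ≟ v
      ... | yes _ = refl
      ... | no ne = ⊥-elim (ne refl)

      view : ∀ {x} → x ∈ xs → (Touched (class x) × class′ x ≡ v) ⊎ (¬ Touched (class x) × class′ x ≡ class x)
      view {x} x∈ with x ≟ v | touched? (class x)
      ... | yes refl | _ = ⊥-elim (All.lookup v∉ x∈ refl)
      ... | no _ | yes t = inj₁ (t , refl)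
      ... | no _ | no ¬t = inj₂ (¬t , refl)

      class-≢v : ∀ {x} → x ∈ xs → class x ≢ v
      class-≢v x∈ e = All.lookup v∉ (class-∈ x∈) (sym e)

      class′-∈ : ∀ {x} → x ∈ v ∷ xs → class′ x ∈ v ∷ xs
      class′-∈ (here refl) = here class′-v
      class′-∈ (there x∈) with view x∈
      ... | inj₁ (_ , e) = here e
      ... | inj₂ (_ , e) = there (subst (_∈ xs) (sym e) (class-∈ x∈))

      class′-touched : ∀ {x} → x ∈ xs → Touched (class x) → class′ x ≡ v
      class′-touched x∈ t with view x∈
      ... | inj₁ (_ , e) = e
      ... | inj₂ (¬t , _) = ⊥-elim (¬t t)

      edge′ : ∀ {x y} → x ∈ v ∷ xs → y ∈ v ∷ xs → R x y → class′ x ≡ class′ y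
      edge′ (here refl) (here refl) _ = refl
      edge′ (here refl) (there y∈) r = trans class′-v (sym (class′-touched y∈ (_ , y∈ , refl , r)))
      edge′ (there x∈) (here refl) r = trans (class′-touched x∈ (_ , x∈ , refl , R-sym r)) (sym class′-v)
      edge′ (there x∈) (there y∈) r with edge x∈ y∈ r | view x∈ | view y∈
      ... | _ | inj₁ (_ , p) | inj₁ (_ , q) = trans p (sym q)
      ... | e | inj₁ (t , _) | inj₂ (¬t , _) = ⊥-elim (¬t (subst Touched e t))
      ... | e | inj₂ (¬t , _) | inj₁ (t , _) = ⊥-elim (¬t (subst Touched (sym e) t))
      ... | e | inj₂ (_ , p) | inj₂ (_ , q) = trans p (trans e (sym q))

      connect′ : (Q : V → Set) → (∀ {x y} → x ∈ v ∷ xs → y ∈ v ∷ xs → R x y → Q x → Q y) →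
                 ∀ {x y} → x ∈ v ∷ xs → y ∈ v ∷ xs → class′ x ≡ class′ y → Q x → Q y
      connect′ Q step = go
        where
        inner : ∀ {x y} → x ∈ xs → y ∈ xs → class x ≡ class y → Q x → Q y
        inner = connect Q λ x∈ y∈ → step (there x∈) (there y∈)

        to-v : ∀ {x} → x ∈ xs → Touched (class x) → Q x → Q v
        to-v x∈ (d , d∈ , e , r) q = step (there d∈) (here refl) (R-sym r) (inner x∈ d∈ (sym e) q)

        from-v : ∀ {x} → x ∈ xs → Touched (class x) → Q v → Q x
        from-v x∈ (d , d∈ , e , r) q = inner d∈ x∈ e (step (here refl) (there d∈) r q)

        go : ∀ {x y} → x ∈ v ∷ xs → y ∈ v ∷ xs → class′ x ≡ class′ y → Q x → Q y
        go (here refl) (here refl) _ q = q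
        go (here refl) (there y∈) e q with view y∈
        ... | inj₁ (t , _) = from-v y∈ t q
        ... | inj₂ (_ , f) = ⊥-elim (class-≢v y∈ (trans (sym f) (trans (sym e) class′-v)))
        go (there x∈) (here refl) e q with view x∈
        ... | inj₁ (t , _) = to-v x∈ t q
        ... | inj₂ (_ , f) = ⊥-elim (class-≢v x∈ (trans (sym f) (trans e class′-v)))
        go (there x∈) (there y∈) e q with view x∈ | view y∈
        ... | inj₁ (s , _) | inj₁ (t , _) = from-v y∈ t (to-v x∈ s q)
        ... | inj₁ (_ , f) | inj₂ (_ , g) = ⊥-elim (class-≢v y∈ (trans (sym g) (trans (sym e) f)))
        ... | inj₂ (_ , f) | inj₁ (_ , g) = ⊥-elim (class-≢v x∈ (trans (sym f) (trans e g)))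
        ... | inj₂ (_ , f) | inj₂ (_ , g) = inner x∈ y∈ (trans (sym f) (trans e g)) q

-- Gallai's theorem.

record GallaiColouring (V C : Set) : Set where
  field
    _≟_      : DecidableEquality V
    _≟ᶜ_     : DecidableEquality C
    colour   : V → V → C
    colour-sym : ∀ x y → colour x y ≡ colour y x
    no-rainbow : ∀ {x y z} → x ≢ y → x ≢ z → y ≢ z → colour x y ≢ colour x z →
                 colour y z ≡ colour x y ⊎ colour y z ≡ colour x z

module Gallai {V C : Set} (G : GallaiColouring V C) where
  open GallaiColouring G

  _∈₂_ : C → C × C → Set
  t ∈₂ (a , b) = t ≡ a ⊎ t ≡ b

  _∈₂?_ : ∀ t ab → Dec (t ∈₂ ab)
  t ∈₂? (a , b) = (t ≟ᶜ a) ⊎-dec (t ≟ᶜ b)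

  record Partition (xs : List V) : Set where
    field
      ab      : C × C
      class   : V → V
      cross   : ∀ {x y} → x ∈ xs → y ∈ xs → class x ≢ class y → colour x y ∈₂ ab
      module-law : ∀ {x y z} → x ∈ xs → y ∈ xs → z ∈ xs → class x ≡ class y → class z ≢ class x →
                   colour z x ≡ colour z y
      left right : V
      left∈   : left ∈ xs
      right∈  : right ∈ xs
      proper  : class left ≢ class right

  -- A cut crossed by at most two colours. This is the form in which the induction runs, since
  -- `partition` refines every such cut to modules.
  record Split (xs : List V) : Set₁ where
    field
      ab      : C × C
      Side    : V → Set
      side?   : ∀ x → Dec (Side x)
      left right : V
      left∈   : left ∈ xs
      right∈  : right ∈ xs
      on-left : Side left
      on-right : ¬ Side right
      across  : ∀ {x y} → x ∈ xs → y ∈ xs → Side x → ¬ Side y → colour x y ∈₂ ab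

  -- The classes are the components of the graph formed by all other colours. They are modules:
  -- an edge wx of another colour cannot be seen in two different colours from outside its component.
  partition : ∀ {xs} → Unique xs → Split xs → Partition xs
  partition {xs} xs! S = record
    { ab = ab ; class = class ; cross = cross ; module-law = module-law
    ; left = left ; right = right ; left∈ = left∈ ; right∈ = right∈
    ; proper = λ e → on-right (connect Side keep left∈ right∈ e on-left) }
    where
    open Split S
    R : V → V → Set
    R x y = ¬ colour x y ∈₂ ab

    R-sym : ∀ {x y} → R x y → R y x
    R-sym {x} {y} = subst (λ t → ¬ t ∈₂ ab) (colour-sym x y)

    open Components (components _≟_ (λ x y → ¬? (colour x y ∈₂? ab)) R-sym xs xs!)

    keep : ∀ {x y} → x ∈ xs → y ∈ xs → R x y → Side x → Side y
    keep {x} {y} x∈ y∈ r s with side? y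
    ... | yes s′ = s′
    ... | no ¬s = ⊥-elim (r (across x∈ y∈ s ¬s))

    cross : ∀ {x y} → x ∈ xs → y ∈ xs → class x ≢ class y → colour x y ∈₂ ab
    cross {x} {y} x∈ y∈ ne = decidable-stable (colour x y ∈₂? ab) λ r → ne (edge x∈ y∈ r)

    module-law : ∀ {x y z} → x ∈ xs → y ∈ xs → z ∈ xs → class x ≡ class y → class z ≢ class x →
                 colour z x ≡ colour z y
    module-law {x} {y} {z} x∈ y∈ z∈ e ne =
      proj₂ (connect (λ w → class x ≡ class w × colour z x ≡ colour z w) step x∈ y∈ e (refl , refl))
      where
      step : ∀ {w w′} → w ∈ xs → w′ ∈ xs → R w w′ →
             class x ≡ class w × colour z x ≡ colour z w → class x ≡ class w′ × colour z x ≡ colour z w′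
      step {w} {w′} w∈ w′∈ r (p , q) = p′ , decidable-stable (colour z x ≟ᶜ colour z w′) λ ne′ →
        case no-rainbow (λ { refl → ne (sym p) }) (λ { refl → ne (sym p′) }) (λ { refl → ne′ q })
               (λ f → ne′ (trans q f)) of λ where
          (inj₁ f) → r (subst (_∈₂ ab) (sym f) (cross z∈ w∈ λ g → ne (trans g (sym p))))
          (inj₂ f) → r (subst (_∈₂ ab) (sym f) (cross z∈ w′∈ λ g → ne (trans g (sym p′))))
        where p′ = trans p (edge w∈ w′∈ r)

  -- The induction step from `xs` to v ∷ `xs`. A class that v sees only in the colours of `ab` can
  -- be cut off; if there is none, `AllHit` applies.
  module Step {v : V} {xs : List V} (v∉ : v ∉ xs) (P : Partition xs) where
    open Partition P

    ≢v : ∀ {x} → x ∈ xs → v ≢ x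
    ≢v x∈ refl = v∉ x∈

    Hit : V → Set
    Hit x = ∃ λ d → d ∈ xs × class d ≡ class x × ¬ colour v d ∈₂ ab

    hit? : ∀ x → Dec (Hit x)
    hit? x with any? (λ d → (class d ≟ class x) ×-dec ¬? (colour v d ∈₂? ab)) xs
    ... | yes p = let d , d∈ , q = find p in yes (d , d∈ , q)
    ... | no ¬p = no λ (d , d∈ , q) → ¬p (lose d∈ q)

    separate : ∀ {x} → x ∈ xs → ¬ Hit x → Split (v ∷ xs)
    separate {x} x∈ ¬h = record
      { ab = ab ; Side = λ y → y ≢ v × class y ≡ class x ; side? = λ y → ¬? (y ≟ v) ×-dec (class y ≟ class x)
      ; left = x ; right = v ; left∈ = there x∈ ; right∈ = here refl
      ; on-left = (λ e → ≢v x∈ (sym e)) , refl ; on-right = λ (ne , _) → ne refl ; across = across }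
      where
      across : ∀ {y z} → y ∈ v ∷ xs → z ∈ v ∷ xs → y ≢ v × class y ≡ class x → ¬ (z ≢ v × class z ≡ class x) →
               colour y z ∈₂ ab
      across (here refl) _ (ne , _) _ = ⊥-elim (ne refl)
      across {y} (there y∈) (here refl) (_ , e) _ = decidable-stable (colour y v ∈₂? ab)
        λ r → ¬h (y , y∈ , e , subst (λ t → ¬ t ∈₂ ab) (colour-sym y v) r)
      across (there y∈) (there z∈) (_ , e) ¬s =
        cross y∈ z∈ λ f → ¬s ((λ g → ≢v z∈ (sym g)) , trans (sym f) e)

    other : ∀ x → ∃ λ y → y ∈ xs × class x ≢ class y
    other x with class x ≟ class left
    ... | yes e = right , right∈ , λ f → proper (trans (sym e) f)
    ... | no ne = left , left∈ , ne

    -- Every class has a vertex that v sees in a colour outside `ab`. This colour is always `t₀`,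
    -- and the colours of `ab` at v reduce to a single colour t. Thus the vertices seen in t are cut
    -- off from the rest by t and `t₀`, or, if there are none, v is cut off by `t₀`.
    module AllHit (hit : ∀ {x} → x ∈ xs → Hit x) where

      d₀ : V
      d₀ = proj₁ (hit left∈)

      t₀ : C
      t₀ = colour v d₀

      -- If the colours differed, the edge de would repeat one of them, yet between classes only
      -- colours of `ab` occur.
      apart : ∀ {d e} → d ∈ xs → e ∈ xs → class d ≢ class e →
              ¬ colour v d ∈₂ ab → ¬ colour v e ∈₂ ab → colour v d ≡ colour v e
      apart {d} {e} d∈ e∈ ne p q = decidable-stable (colour v d ≟ᶜ colour v e) λ f →
        case no-rainbow (≢v d∈) (≢v e∈) (λ { refl → ne refl }) f of λ where
          (inj₁ g) → p (subst (_∈₂ ab) g (cross d∈ e∈ ne))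
          (inj₂ g) → q (subst (_∈₂ ab) g (cross d∈ e∈ ne))

      -- Two vertices of one class are compared through a vertex of another class.
      third : ∀ {d} → d ∈ xs → ¬ colour v d ∈₂ ab → colour v d ≡ t₀
      third {d} d∈ p with hit left∈
      ... | d₁ , d₁∈ , e₁ , p₁ with class d ≟ class d₁
      ... | no ne = apart d∈ d₁∈ ne p p₁
      ... | yes e with hit right∈
      ... | d₂ , d₂∈ , e₂ , p₂ = trans (apart d∈ d₂∈ (λ f → ne (trans (sym e) f)) p p₂) (sym (apart d₁∈ d₂∈ ne p₁ p₂))
        where
        ne : class d₁ ≢ class d₂
        ne f = proper (trans (sym e₁) (trans f e₂))

      -- The edge wd has a colour of `ab`, so in the triangle vwd it can repeat only the colour of
      -- vw.
      seen : ∀ {w d} → w ∈ xs → d ∈ xs → class w ≢ class d → colour v w ∈₂ ab → ¬ colour v d ∈₂ ab →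
             colour w d ≡ colour v w
      seen {w} {d} w∈ d∈ ne p q =
        case no-rainbow (≢v w∈) (≢v d∈) (λ { refl → ne refl }) (λ f → q (subst (_∈₂ ab) f p)) of λ where
          (inj₁ f) → f
          (inj₂ f) → ⊥-elim (q (subst (_∈₂ ab) f (cross w∈ d∈ ne)))

      -- For different classes, `seen` moves the colour of vw to an edge from w into the class of
      -- w′, and that of vw′ to an edge from w′ into the class of w; by the module law both are the
      -- colour of ww′. Within one class the comparison goes through a vertex d of another class.
      single : ∀ {w w′} → w ∈ xs → w′ ∈ xs → colour v w ∈₂ ab → colour v w′ ∈₂ ab → colour v w ≡ colour v w′
      single {w} {w′} w∈ w′∈ p p′ with class w ≟ class w′
      ... | no ne with hit w∈ | hit w′∈
      ... | d , d∈ , e , q | d′ , d′∈ , e′ , q′ =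
        trans (sym (seen w∈ d′∈ (λ f → ne (trans f e′)) p q′))
          (trans (module-law d′∈ w′∈ w∈ e′ (λ f → ne (trans f e′)))
            (trans (colour-sym w w′)
              (trans (sym (module-law d∈ w∈ w′∈ e (λ f → ne (sym (trans f e)))))
                (seen w′∈ d∈ (λ f → ne (sym (trans f e))) p′ q))))
      single {w} {w′} w∈ w′∈ p p′ | yes e with other w
      ... | y , y∈ , ne with hit y∈
      ... | d , d∈ , f , q =
        trans (sym (seen w∈ d∈ w≢d p q))
          (trans (colour-sym w d) (trans (module-law w∈ w′∈ d∈ e (≢-sym w≢d))
            (trans (colour-sym d w′) (seen w′∈ d∈ (λ g → w≢d (trans e g)) p′ q))))
        where
        w≢d : class w ≢ class d
        w≢d g = ne (trans g f)

      split : Split (v ∷ xs)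
      split with any? (λ w → colour v w ∈₂? ab) xs
      ... | no ¬some = record
        { ab = t₀ , t₀ ; Side = _≡ v ; side? = _≟ v ; left = v ; right = left ; left∈ = here refl ; right∈ = there left∈
        ; on-left = refl ; on-right = λ e → ≢v left∈ (sym e)
        ; across = λ where
            _ (here refl) refl ne → ⊥-elim (ne refl)
            _ (there y∈) refl _ → inj₁ (third y∈ λ p → ¬some (lose y∈ p)) }
      ... | yes some with find some
      ... | w , w∈ , p = record
        { ab = t , t₀ ; Side = Side ; side? = λ x → ¬? (x ≟ v) ×-dec (colour v x ≟ᶜ t)
        ; left = w ; right = v ; left∈ = there w∈ ; right∈ = here refl
        ; on-left = (λ e → ≢v w∈ (sym e)) , refl ; on-right = λ (ne , _) → ne refl ; across = across }
        where
        t = colour v w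
        Side : V → Set
        Side x = x ≢ v × colour v x ≡ t
        across : ∀ {x y} → x ∈ v ∷ xs → y ∈ v ∷ xs → Side x → ¬ Side y → colour x y ∈₂ (t , t₀)
        across (here refl) _ (ne , _) _ = ⊥-elim (ne refl)
        across {x} (there x∈) (here refl) (_ , e) _ = inj₁ (trans (colour-sym x v) e)
        across {x} {y} (there x∈) (there y∈) (x≢v , e) ¬s with colour v y ∈₂? ab
        ... | yes q = ⊥-elim (¬s ((λ f → ≢v y∈ (sym f)) , single y∈ w∈ q p))
        ... | no q = case no-rainbow (≢v x∈) (≢v y∈) (λ { refl → ¬s (x≢v , e) })
                (λ f → q (subst (_∈₂ ab) (trans (sym e) f) p)) of λ where
          (inj₁ f) → inj₁ (trans f e)
          (inj₂ f) → inj₂ (trans f (third y∈ q))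

    extend-split : Split (v ∷ xs)
    extend-split with any? (λ x → ¬? (hit? x)) xs
    ... | yes p = let x , x∈ , ¬h = find p in separate x∈ ¬h
    ... | no ¬p = AllHit.split λ {x} x∈ → decidable-stable (hit? x) λ ¬h → ¬p (lose x∈ ¬h)

  split : ∀ xs → Unique xs → 2 ≤ length xs → Split xs
  split (_ ∷ []) _ (s≤s ())
  split (x ∷ y ∷ []) ((x≢y ∷ []) ∷ _) _ = record
    { ab = colour x y , colour x y ; Side = _≡ x ; side? = _≟ x ; left = x ; right = y
    ; left∈ = here refl ; right∈ = there (here refl) ; on-left = refl ; on-right = λ e → x≢y (sym e)
    ; across = λ where
        _ (here refl) refl ne → ⊥-elim (ne refl)
        _ (there (here refl)) refl _ → inj₁ refl }
  split (v ∷ xs@(_ ∷ _ ∷ _)) (v∉ ∷ xs!) _ =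
    Step.extend-split (λ v∈ → All.lookup v∉ v∈ refl) (partition xs! (split xs xs! (s≤s (s≤s z≤n))))

  gallai : ∀ {xs} → Unique xs → 2 ≤ length xs → Partition xs
  gallai {xs} xs! 2≤ = partition xs! (split xs xs! 2≤)

-- The upper bound

-- The value at 0 is the case in which all edges form a matching, so that there are at most two
-- vertices.
bound : ℕ → ℕ
bound 0 = 2
bound 1 = 4
bound 2 = 14
bound 3 = 28
bound (suc (suc k@(suc (suc _)))) = 5 * bound k

2≤bound : ∀ k → 2 ≤ bound k
2≤bound 0 = s≤s (s≤s z≤n)
2≤bound 1 = s≤s (s≤s z≤n)
2≤bound 2 = s≤s (s≤s z≤n)
2≤bound 3 = s≤s (s≤s z≤n)
2≤bound (suc (suc k@(suc (suc _)))) = ≤-trans (2≤bound k) (m≤n*m (bound k) 5)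

bound-double : ∀ k → bound k + bound k ≤ bound (suc k)
bound-double 0 = ≤-refl
bound-double 1 = m≤m+n 8 6
bound-double 2 = ≤-refl
bound-double 3 = m≤m+n 56 14
bound-double (suc (suc k@(suc (suc _)))) =
  ≤-trans (≤-reflexive (sym (*-distribˡ-+ 5 (bound k) (bound k)))) (*-monoʳ-≤ 5 (bound-double k))

bound-five : ∀ k → 5 * bound k ≤ bound (suc (suc k))
bound-five 0 = m≤m+n 10 4
bound-five 1 = m≤m+n 20 8
bound-five (suc (suc k)) = ≤-refl

bound+2 : ∀ k → 2 + bound k ≤ bound (suc k)
bound+2 k = ≤-trans (+-monoˡ-≤ (bound k) (2≤bound k)) (bound-double k)

k+2≤bound : ∀ k → 2 + k ≤ bound k
k+2≤bound zero = ≤-refl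
k+2≤bound (suc k) = ≤-trans (s≤s (k+2≤bound k)) (≤-trans (n≤1+n _) (bound+2 k))

14+k≤bound : ∀ k → 14 + (3 + k) ≤ bound (3 + k)
14+k≤bound zero = m≤m+n 17 11
14+k≤bound (suc k) = ≤-trans (s≤s (14+k≤bound k)) (≤-trans (n≤1+n _) (bound+2 (3 + k)))

-- Lists of restricted colours and the moves between them.

module Upper {V C : Set} (G : GallaiColouring V C) where
  open GallaiColouring G
  open Gallai G

  -- The colours on the diagonal are arbitrary here, so distinctness of the ends is part of an edge.
  Edge : C → V → V → Set
  Edge t x y = x ≢ y × colour x y ≡ t

  flip : ∀ {t x y} → Edge t x y → Edge t y x
  flip {x = x} {y} (ne , e) = ≢-sym ne , trans (colour-sym y x) e

  NoW5 NoC4 NoP3 : C → List V → Set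
  NoW5 t xs = ∀ {h a p c q} → h ∈ xs → a ∈ xs → p ∈ xs → c ∈ xs → q ∈ xs →
    Edge t h a → Edge t h p → Edge t h c → Edge t h q →
    Edge t a p → Edge t p c → Edge t c q → Edge t q a → a ≢ c → p ≢ q → ⊥
  NoC4 t xs = ∀ {a p c q} → a ∈ xs → p ∈ xs → c ∈ xs → q ∈ xs →
    Edge t a p → Edge t p c → Edge t c q → Edge t q a → a ≢ c → p ≢ q → ⊥
  NoP3 t xs = ∀ {x y z} → x ∈ xs → y ∈ xs → z ∈ xs → Edge t x y → Edge t x z → y ≢ z → ⊥

  _⊑_ : List V → List V → Set
  ys ⊑ xs = ∀ {y} → y ∈ ys → y ∈ xs

  Joined : C → V → List V → Set
  Joined t u ys = ∀ {y} → y ∈ ys → Edge t u y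

  module _ {t : C} {xs ys : List V} (ys⊑ : ys ⊑ xs) where

    -- A path with centre x and ends y, z would give a wheel with hub x and rim u, y, u′, z.
    P3-free : ∀ {u u′} → u ∈ xs → u′ ∈ xs → u ≢ u′ → Joined t u ys → Joined t u′ ys → NoW5 t xs → NoP3 t ys
    P3-free u∈ u′∈ u≢u′ ju ju′ free x∈ y∈ z∈ xy xz y≢z =
      free (ys⊑ x∈) u∈ (ys⊑ y∈) u′∈ (ys⊑ z∈) (flip (ju x∈)) xy (flip (ju′ x∈)) xz
        (ju y∈) (flip (ju′ y∈)) (ju′ z∈) (flip (ju z∈)) u≢u′ y≢z

    C4-free : ∀ {u} → u ∈ xs → Joined t u ys → NoW5 t xs → NoC4 t ys
    C4-free u∈ ju free a∈ p∈ c∈ q∈ = free u∈ (ys⊑ a∈) (ys⊑ p∈) (ys⊑ c∈) (ys⊑ q∈) (ju a∈) (ju p∈) (ju c∈) (ju q∈)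

    P3-free′ : ∀ {u} → u ∈ xs → Joined t u ys → NoC4 t xs → NoP3 t ys
    P3-free′ u∈ ju free x∈ y∈ z∈ xy xz =
      free u∈ (ys⊑ y∈) (ys⊑ x∈) (ys⊑ z∈) (ju y∈) (flip xy) xz (flip (ju z∈)) (proj₁ (ju x∈))

  record Good (xs : List V) (F D : List C) : Set where
    field
      full : ∀ {t} → t ∈ F → NoW5 t xs
      cyc  : ∀ {t} → t ∈ D → NoC4 t xs
      rest : ∀ {x y z} → x ∈ xs → y ∈ xs → z ∈ xs → x ≢ y → x ≢ z → y ≢ z →
             ¬ (colour x y ∈ F ⊎ colour x y ∈ D) → ¬ (colour x z ∈ F ⊎ colour x z ∈ D) → ⊥
  open Good

  restrict : ∀ {xs ys F D} → ys ⊑ xs → Good xs F D → Good ys F D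
  restrict s g = record
    { full = λ t∈ h a p c q → full g t∈ (s h) (s a) (s p) (s c) (s q)
    ; cyc = λ t∈ a p c q → cyc g t∈ (s a) (s p) (s c) (s q)
    ; rest = λ x y z → rest g (s x) (s y) (s z) }

  record Deletion (t : C) (F F′ : List C) : Set where
    field
      len   : length F ≡ suc (length F′)
      sub   : ∀ {s} → s ∈ F′ → s ∈ F
      cover : ∀ {s} → s ∈ F → s ≡ t ⊎ s ∈ F′
  open Deletion

  delete : ∀ {t F} → t ∈ F → ∃ (Deletion t F)
  delete {F = _ ∷ F} (here refl) = F , record
    { len = refl ; sub = there ; cover = λ { (here e) → inj₁ e ; (there p) → inj₂ p } }
  delete {F = s ∷ F} (there t∈) with delete t∈
  ... | F′ , δ = s ∷ F′ , record
    { len = cong suc (len δ)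
    ; sub = λ { (here e) → here e ; (there p) → there (sub δ p) }
    ; cover = λ { (here e) → inj₂ (here e)
                ; (there p) → case cover δ p of λ { (inj₁ e) → inj₁ e ; (inj₂ q) → inj₂ (there q) } } }

  -- If t and the colours outside L form matchings, then so does their union: a path of length two
  -- with colours t and s ∉ L would be closed by an edge of colour t or s.
  absorb : ∀ {t xs} {L L′ : C → Set} → NoP3 t xs → (∀ {s} → L s → s ≡ t ⊎ L′ s) →
    (∀ {x y z} → x ∈ xs → y ∈ xs → z ∈ xs → x ≢ y → x ≢ z → y ≢ z →
      ¬ L (colour x y) → ¬ L (colour x z) → ⊥) →
    (∀ {x y z} → x ∈ xs → y ∈ xs → z ∈ xs → x ≢ y → x ≢ z → y ≢ z →
      ¬ L′ (colour x y) → ¬ L′ (colour x z) → ⊥)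
  absorb {t} {xs} {L} {L′} noP3 cover old {x} {y} {z} x∈ y∈ z∈ x≢y x≢z y≢z p q
    with colour x y ≟ᶜ t | colour x z ≟ᶜ t
  ... | yes e | yes f = noP3 x∈ y∈ z∈ (x≢y , e) (x≢z , f) y≢z
  ... | no ne | no nf = old x∈ y∈ z∈ x≢y x≢z y≢z (lift ne p) (lift nf q)
    where
    lift : ∀ {s} → s ≢ t → ¬ L′ s → ¬ L s
    lift ne p l = case cover l of λ { (inj₁ e) → ne e ; (inj₂ l′) → p l′ }
  ... | yes e | no nf = case no-rainbow x≢y x≢z y≢z (λ g → nf (trans (sym g) e)) of λ where
      (inj₁ g) → noP3 y∈ x∈ z∈ (flip (x≢y , e)) (y≢z , trans g e) x≢z
      (inj₂ g) → old z∈ x∈ y∈ (≢-sym x≢z) (≢-sym y≢z) x≢y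
        (subst (λ s → ¬ L s) (colour-sym x z) nl) (subst (λ s → ¬ L s) (trans (sym g) (colour-sym y z)) nl)
    where
    nl : ¬ L (colour x z)
    nl l = case cover l of λ { (inj₁ e) → nf e ; (inj₂ l′) → q l′ }
  ... | no ne | yes f = case no-rainbow x≢y x≢z y≢z (λ g → ne (trans g f)) of λ where
      (inj₂ g) → noP3 z∈ x∈ y∈ (flip (x≢z , f)) (flip (y≢z , trans g f)) x≢y
      (inj₁ g) → old y∈ x∈ z∈ (≢-sym x≢y) y≢z x≢z
        (subst (λ s → ¬ L s) (colour-sym x y) nl) (subst (λ s → ¬ L s) (sym g) nl)
    where
    nl : ¬ L (colour x y)
    nl l = case cover l of λ { (inj₁ e) → ne e ; (inj₂ l′) → p l′ }

  drop-full : ∀ {t xs F F′ D} → Deletion t F F′ → NoP3 t xs → Good xs F D → Good xs F′ D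
  drop-full {t} {xs} {F} {F′} {D} δ noP3 g = record
    { full = λ s∈ → full g (sub δ s∈) ; cyc = cyc g
    ; rest = absorb {L = λ s → s ∈ F ⊎ s ∈ D} {L′ = λ s → s ∈ F′ ⊎ s ∈ D} noP3 cov (rest g) }
    where
    cov : ∀ {s} → s ∈ F ⊎ s ∈ D → s ≡ t ⊎ s ∈ F′ ⊎ s ∈ D
    cov (inj₂ p) = inj₂ (inj₂ p)
    cov (inj₁ p) with cover δ p
    ... | inj₁ e = inj₁ e
    ... | inj₂ q = inj₂ (inj₁ q)

  drop-cyc : ∀ {t xs F D D′} → Deletion t D D′ → NoP3 t xs → Good xs F D → Good xs F D′
  drop-cyc {t} {xs} {F} {D} {D′} δ noP3 g = record
    { full = full g ; cyc = λ s∈ → cyc g (sub δ s∈)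
    ; rest = absorb {L = λ s → s ∈ F ⊎ s ∈ D} {L′ = λ s → s ∈ F ⊎ s ∈ D′} noP3 cov (rest g) }
    where
    cov : ∀ {s} → s ∈ F ⊎ s ∈ D → s ≡ t ⊎ s ∈ F ⊎ s ∈ D′
    cov (inj₁ p) = inj₂ (inj₁ p)
    cov (inj₂ p) with cover δ p
    ... | inj₁ e = inj₁ e
    ... | inj₂ q = inj₂ (inj₂ q)

  weaken-full : ∀ {t xs F F′ D} → Deletion t F F′ → NoC4 t xs → Good xs F D → Good xs F′ (t ∷ D)
  weaken-full {t} {xs} {F} {F′} {D} δ noC4 g = record
    { full = λ s∈ → full g (sub δ s∈)
    ; cyc = λ { (here refl) → noC4 ; (there s∈) → cyc g s∈ }
    ; rest = λ x∈ y∈ z∈ a b c p q → rest g x∈ y∈ z∈ a b c (p ∘ cov) (q ∘ cov) }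
    where
    cov : ∀ {s} → s ∈ F ⊎ s ∈ D → s ∈ F′ ⊎ s ∈ t ∷ D
    cov (inj₂ p) = inj₂ (there p)
    cov (inj₁ p) with cover δ p
    ... | inj₁ e = inj₂ (here e)
    ... | inj₂ q = inj₁ q

  Two : List V → Set
  Two xs = ∃ λ u → ∃ λ v → u ∈ xs × v ∈ xs × u ≢ v

  two? : ∀ xs → Unique xs → Two xs ⊎ length xs ≤ 1
  two? [] _ = inj₂ z≤n
  two? (x ∷ []) _ = inj₂ ≤-refl
  two? (x ∷ y ∷ xs) ((x≢y ∷ _) ∷ _) = inj₁ (x , y , here refl , there (here refl) , x≢y)

  -- The summand `length D` pays for a vertex joined in one colour to all others: deleting the
  -- vertex while its colour moves from F to D keeps both sides unchanged.
  Bounded : List V → List C → List C → Set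
  Bounded xs F D = length xs + length D ≤ bound (length F + length D)

  _∈ᶜ?_ : ∀ t (F : List C) → Dec (t ∈ F)
  t ∈ᶜ? F = any? (t ≟ᶜ_) F

  lookup-injective : ∀ {xs : List V} → Unique xs → ∀ i j → lookup xs i ≡ lookup xs j → i ≡ j
  lookup-injective (_ ∷ _) zero zero _ = refl
  lookup-injective (x∉ ∷ _) zero (suc j) e = ⊥-elim (All.lookup x∉ (∈-lookup j) e)
  lookup-injective (x∉ ∷ _) (suc i) zero e = ⊥-elim (All.lookup x∉ (∈-lookup i) (sym e))
  lookup-injective (_ ∷ xs!) (suc i) (suc j) e = cong suc (lookup-injective xs! i j e)

  -- Positions in `xs` replace the vertices, because the laws of `TwoColouring` must hold on a whole
  -- type and not just on the members of a list.
  module TwoColoured {s t : C} {xs : List V} (xs! : Unique xs)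
    (two : ∀ {x y} → x ∈ xs → y ∈ xs → x ≢ y → colour x y ∈₂ (s , t)) (freeₛ : NoW5 s xs) (freeₜ : NoW5 t xs) where

    N = length xs

    at : Fin N → V
    at = lookup xs

    at∈ : ∀ i → at i ∈ xs
    at∈ i = ∈-lookup i

    χ : Fin N → Fin N → Hue
    χ i j with i Fin.≟ j | colour (at i) (at j) ≟ᶜ s
    ... | yes _ | _ = none
    ... | no _ | yes _ = red
    ... | no _ | no _ = blue

    χ-red : ∀ {i j} → χ i j ≡ red → Edge s (at i) (at j)
    χ-red {i} {j} e with i Fin.≟ j | colour (at i) (at j) ≟ᶜ s
    χ-red {i} {j} () | yes _ | _
    ... | no ne | yes c = (λ f → ne (lookup-injective xs! i j f)) , c

    χ-blue : ∀ {i j} → χ i j ≡ blue → Edge t (at i) (at j)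
    χ-blue {i} {j} e with i Fin.≟ j | colour (at i) (at j) ≟ᶜ s
    χ-blue {i} {j} () | yes _ | _
    ... | no ne | no nc = i≢j , (case two (at∈ i) (at∈ j) i≢j of λ { (inj₁ c) → ⊥-elim (nc c) ; (inj₂ c) → c })
      where i≢j = λ f → ne (lookup-injective xs! i j f)

    G₂ : TwoColouring (Fin N)
    G₂ = record { χ = χ ; χ-sym = χ-sym ; χ-diag = χ-diag ; χ-none = χ-none ; no-W5 = λ {τ} → no-W5 τ }
      where
      χ-sym : ∀ i j → χ i j ≡ χ j i
      χ-sym i j with i Fin.≟ j | j Fin.≟ i | colour (at i) (at j) ≟ᶜ s | colour (at j) (at i) ≟ᶜ s
      ... | yes _ | yes _ | _ | _ = refl
      ... | yes p | no q | _ | _ = ⊥-elim (q (sym p))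
      ... | no p | yes q | _ | _ = ⊥-elim (p (sym q))
      ... | no _ | no _ | yes _ | yes _ = refl
      ... | no _ | no _ | no _ | no _ = refl
      ... | no _ | no _ | yes p | no q = ⊥-elim (q (trans (colour-sym _ _) p))
      ... | no _ | no _ | no p | yes q = ⊥-elim (p (trans (colour-sym _ _) q))

      χ-diag : ∀ i → χ i i ≡ none
      χ-diag i with i Fin.≟ i
      ... | yes _ = refl
      ... | no ne = ⊥-elim (ne refl)

      χ-none : ∀ {i j} → χ i j ≡ none → i ≡ j
      χ-none {i} {j} e with i Fin.≟ j | colour (at i) (at j) ≟ᶜ s
      ... | yes p | _ = p
      χ-none {i} {j} () | no _ | yes _
      χ-none {i} {j} () | no _ | no _

      no-W5 : ∀ τ {h a p c q} → τ ≢ none →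
        χ h a ≡ τ → χ h p ≡ τ → χ h c ≡ τ → χ h q ≡ τ →
        χ a p ≡ τ → χ p c ≡ τ → χ c q ≡ τ → χ q a ≡ τ → a ≢ c → p ≢ q → ⊥
      no-W5 none τ≢ _ _ _ _ _ _ _ _ _ _ = τ≢ refl
      no-W5 red {h} {a} {p} {c} {q} _ e₁ e₂ e₃ e₄ e₅ e₆ e₇ e₈ ac pq =
        freeₛ (at∈ h) (at∈ a) (at∈ p) (at∈ c) (at∈ q) (χ-red e₁) (χ-red e₂) (χ-red e₃) (χ-red e₄)
          (χ-red e₅) (χ-red e₆) (χ-red e₇) (χ-red e₈) (ac ∘ lookup-injective xs! a c) (pq ∘ lookup-injective xs! p q)
      no-W5 blue {h} {a} {p} {c} {q} _ e₁ e₂ e₃ e₄ e₅ e₆ e₇ e₈ ac pq =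
        freeₜ (at∈ h) (at∈ a) (at∈ p) (at∈ c) (at∈ q) (χ-blue e₁) (χ-blue e₂) (χ-blue e₃) (χ-blue e₄)
          (χ-blue e₅) (χ-blue e₆) (χ-blue e₇) (χ-blue e₈) (ac ∘ lookup-injective xs! a c) (pq ∘ lookup-injective xs! p q)

    C4-red : NoC4 s xs → NoC4ʰ G₂ red
    C4-red free {a} {p} {c} {q} e₁ e₂ e₃ e₄ ac pq = free (at∈ a) (at∈ p) (at∈ c) (at∈ q)
      (χ-red e₁) (χ-red e₂) (χ-red e₃) (χ-red e₄) (ac ∘ lookup-injective xs! a c) (pq ∘ lookup-injective xs! p q)

    C4-blue : NoC4 t xs → NoC4ʰ G₂ blue
    C4-blue free {a} {p} {c} {q} e₁ e₂ e₃ e₄ ac pq = free (at∈ a) (at∈ p) (at∈ c) (at∈ q)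
      (χ-blue e₁) (χ-blue e₂) (χ-blue e₃) (χ-blue e₄) (ac ∘ lookup-injective xs! a c) (pq ∘ lookup-injective xs! p q)

    via : ∀ {m} → (∀ (is : List (Fin N)) → Unique is → suc m ≤ length is → ⊥) → N ≤ m
    via {m} absurd = ≮⇒≥ λ m< → absurd (allFin N) (Unique.allFin⁺ N)
      (≤-trans m< (≤-reflexive (sym (List.length-tabulate {n = N} (λ i → i)))))

    size≤14 : N ≤ 14
    size≤14 = via (ramsey G₂)

    size≤13 : NoC4 s xs → N ≤ 13
    size≤13 free = via (ramsey₁ G₂ (C4-red free))

    size≤12 : NoC4 s xs → NoC4 t xs → N ≤ 12
    size≤12 freeₛ′ freeₜ′ = via (ramsey₂ G₂ (C4-red freeₛ′) (C4-blue freeₜ′))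

  C4⇒W5-free : ∀ {t xs} → NoC4 t xs → NoW5 t xs
  C4⇒W5-free free _ a∈ p∈ c∈ q∈ _ _ _ _ = free a∈ p∈ c∈ q∈

  -- With exactly two listed colours the bound 14 is met as 14 + 0, 13 + 1 or 12 + 2, according to
  -- the size of D. From three listed colours on, at most 14 vertices are few enough for any D.
  two-coloured : ∀ {s t xs F D} → Unique xs → s ≢ t → Good xs F D → s ∈ F ⊎ s ∈ D → t ∈ F ⊎ t ∈ D →
    (∀ {x y} → x ∈ xs → y ∈ xs → x ≢ y → colour x y ∈₂ (s , t)) → Bounded xs F D
  two-coloured {s} {t} {xs} {F} {D} xs! s≢t g ls lt two = by-size F D g ls lt
    where
    W5-free : ∀ {F D t} → Good xs F D → t ∈ F ⊎ t ∈ D → NoW5 t xs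
    W5-free g (inj₁ t∈) = full g t∈
    W5-free g (inj₂ t∈) = C4⇒W5-free (cyc g t∈)

    swapped : ∀ {x y} → x ∈ xs → y ∈ xs → x ≢ y → colour x y ∈₂ (t , s)
    swapped x∈ y∈ ne = case two x∈ y∈ ne of λ { (inj₁ e) → inj₂ e ; (inj₂ e) → inj₁ e }

    large : ∀ {F D} m → length F + length D ≡ 3 + m → Good xs F D → s ∈ F ⊎ s ∈ D → t ∈ F ⊎ t ∈ D → Bounded xs F D
    large {F} {D} m e g ls lt = begin
      length xs + length D         ≤⟨ +-mono-≤ (TwoColoured.size≤14 xs! two (W5-free g ls) (W5-free g lt)) (m≤n+m (length D) (length F)) ⟩
      14 + (length F + length D)   ≡⟨ cong (14 +_) e ⟩
      14 + (3 + m)                 ≤⟨ 14+k≤bound m ⟩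
      bound (3 + m)                ≡⟨ cong bound (sym e) ⟩
      bound (length F + length D)  ∎
      where
      open ≤-Reasoning

    by-size : ∀ F D → Good xs F D → s ∈ F ⊎ s ∈ D → t ∈ F ⊎ t ∈ D → Bounded xs F D
    by-size [] [] _ (inj₁ ()) _
    by-size [] [] _ (inj₂ ()) _
    by-size (_ ∷ []) [] _ (inj₁ (here refl)) (inj₁ (here refl)) = ⊥-elim (s≢t refl)
    by-size [] (_ ∷ []) _ (inj₂ (here refl)) (inj₂ (here refl)) = ⊥-elim (s≢t refl)
    by-size (_ ∷ _ ∷ []) [] g ls lt =
      +-monoˡ-≤ 0 (TwoColoured.size≤14 xs! two (W5-free g ls) (W5-free g lt))
    by-size (_ ∷ []) (_ ∷ []) g ls@(inj₂ s∈) lt =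
      +-monoˡ-≤ 1 (TwoColoured.size≤13 xs! two (W5-free g ls) (W5-free g lt) (cyc g s∈))
    by-size (_ ∷ []) (_ ∷ []) g ls lt@(inj₂ t∈) =
      +-monoˡ-≤ 1 (TwoColoured.size≤13 xs! swapped (W5-free g lt) (W5-free g ls) (cyc g t∈))
    by-size (_ ∷ []) (_ ∷ []) g (inj₁ (here refl)) (inj₁ (here refl)) = ⊥-elim (s≢t refl)
    by-size [] (_ ∷ _ ∷ []) g ls@(inj₂ s∈) lt@(inj₂ t∈) =
      +-monoˡ-≤ 2 (TwoColoured.size≤12 xs! two (W5-free g ls) (W5-free g lt) (cyc g s∈) (cyc g t∈))
    by-size (_ ∷ _ ∷ _ ∷ F) D = large (length F + length D) refl
    by-size (_ ∷ _ ∷ []) (_ ∷ D) = large (length D) refl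
    by-size (_ ∷ []) (_ ∷ _ ∷ D) = large (length D) refl
    by-size [] (_ ∷ _ ∷ _ ∷ D) = large (length D) refl

  ¬Two⇒≡ : ∀ {xs : List V} {x y} → length xs ≤ 1 → x ∈ xs → y ∈ xs → x ≡ y
  ¬Two⇒≡ _ (here refl) (here refl) = refl
  ¬Two⇒≡ {_ ∷ _ ∷ _} (s≤s ()) _ (there _)
  ¬Two⇒≡ {_ ∷ _ ∷ _} (s≤s ()) (there _) _

  -- The induction step of the upper bound.

  module Induction (n : ℕ)
    (ih : ∀ {ys F D} → length ys ≤ n → Unique ys → Good ys F D → Bounded ys F D)
    {xs : List V} {F D : List C} (xs≤ : length xs ≤ suc n) (xs! : Unique xs) (g : Good xs F D) where

    Listed : C → Set
    Listed t = t ∈ F ⊎ t ∈ D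

    listed? : ∀ t → Dec (Listed t)
    listed? t = (t ∈ᶜ? F) ⊎-dec (t ∈ᶜ? D)

    smaller : ∀ {P : V → Set} (P? : ∀ x → Dec (P x)) {x} → x ∈ xs → ¬ P x → length (filter P? xs) ≤ n
    smaller P? x∈ ¬p = ≤-pred (≤-trans (List.filter-notAll P? xs (lose x∈ ¬p)) xs≤)

    -- The four edges form a C₄, so t is not in D, and two of them meet, so t is not unlisted.
    joined-pairs : ∀ {t u u′ v v′} → u ∈ xs → u′ ∈ xs → v ∈ xs → v′ ∈ xs → u ≢ u′ → v ≢ v′ →
      Edge t u v → Edge t u v′ → Edge t u′ v → Edge t u′ v′ → t ∈ F
    joined-pairs {t} u∈ u′∈ v∈ v′∈ u≢ v≢ uv uv′ u′v u′v′ with listed? t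
    ... | yes (inj₁ t∈F) = t∈F
    ... | yes (inj₂ t∈D) = ⊥-elim (cyc g t∈D u∈ v∈ u′∈ v′∈ uv (flip u′v) u′v′ (flip uv′) u≢ v≢)
    ... | no ¬l = ⊥-elim (rest g u∈ v∈ v′∈ (proj₁ uv) (proj₁ uv′) v≢
            (subst (λ s → ¬ Listed s) (sym (proj₂ uv)) ¬l) (subst (λ s → ¬ Listed s) (sym (proj₂ uv′)) ¬l))

    -- If t is in F, it moves to D. If t is in D, it joins the matching, and the bound drops by at
    -- least 2, which pays for u and for the shorter D. If t is unlisted, u has at most one edge and
    -- `ys` at most one vertex.
    peel : ∀ {t u ys} → u ∈ xs → ys ⊑ xs → Unique ys → Joined t u ys → length ys ≤ n →
      length xs ≤ suc (length ys) → Bounded xs F D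
    peel {t} {u} {ys} u∈ ys⊑ ys! ju ys≤ xs≤ys with listed? t
    ... | yes (inj₁ t∈F) with F′ , δ ← delete t∈F = begin
        length xs + length D              ≤⟨ +-monoˡ-≤ (length D) xs≤ys ⟩
        suc (length ys) + length D        ≡⟨ sym (+-suc (length ys) (length D)) ⟩
        length ys + length (t ∷ D)        ≤⟨ ih ys≤ ys! (weaken-full δ (C4-free ys⊑ u∈ ju (full g t∈F)) (restrict ys⊑ g)) ⟩
        bound (length F′ + length (t ∷ D)) ≡⟨ cong bound (+-suc (length F′) (length D)) ⟩
        bound (suc (length F′) + length D) ≡⟨ cong (λ f → bound (f + length D)) (sym (len δ)) ⟩
        bound (length F + length D)       ∎
      where
      open ≤-Reasoning
    ... | yes (inj₂ t∈D) with D′ , δ ← delete t∈D = begin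
        length xs + length D                ≡⟨ cong (length xs +_) (len δ) ⟩
        length xs + suc (length D′)         ≤⟨ +-monoˡ-≤ (suc (length D′)) xs≤ys ⟩
        suc (length ys) + suc (length D′)   ≡⟨ cong suc (+-suc (length ys) (length D′)) ⟩
        2 + (length ys + length D′)         ≤⟨ +-monoʳ-≤ 2 (ih ys≤ ys! (drop-cyc δ (P3-free′ ys⊑ u∈ ju (cyc g t∈D)) (restrict ys⊑ g))) ⟩
        2 + bound (length F + length D′)    ≤⟨ bound+2 (length F + length D′) ⟩
        bound (suc (length F + length D′))  ≡⟨ cong bound (sym (+-suc (length F) (length D′))) ⟩
        bound (length F + suc (length D′))  ≡⟨ cong (λ d → bound (length F + d)) (sym (len δ)) ⟩
        bound (length F + length D)         ∎
      where
      open ≤-Reasoning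
    ... | no ¬l with two? ys ys!
    ... | inj₁ (v , v′ , v∈ , v′∈ , v≢v′) = ⊥-elim (rest g u∈ (ys⊑ v∈) (ys⊑ v′∈) (proj₁ (ju v∈)) (proj₁ (ju v′∈)) v≢v′
            (subst (λ s → ¬ Listed s) (sym (proj₂ (ju v∈))) ¬l) (subst (λ s → ¬ Listed s) (sym (proj₂ (ju v′∈))) ¬l))
    ... | inj₂ ys≤1 = begin
        length xs + length D         ≤⟨ +-mono-≤ (≤-trans xs≤ys (s≤s ys≤1)) (m≤n+m (length D) (length F)) ⟩
        2 + (length F + length D)    ≤⟨ k+2≤bound (length F + length D) ⟩
        bound (length F + length D)  ∎
      where
      open ≤-Reasoning

    -- A cut into A and B crossed by a single colour t. A side with at most one vertex is peeled
    -- off. Otherwise t lies in F and becomes a matching in both sides, and `bound-double` adds up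
    -- the two halves.
    module Join {t : C} {P : V → Set} (P? : ∀ x → Dec (P x)) {l r : V}
      (l∈ : l ∈ xs) (Pl : P l) (r∈ : r ∈ xs) (¬Pr : ¬ P r)
      (mono : ∀ {x y} → x ∈ xs → y ∈ xs → P x → ¬ P y → colour x y ≡ t) where

      ¬P? : ∀ x → Dec (¬ P x)
      ¬P? x = ¬? (P? x)

      A B : List V
      A = filter P? xs
      B = filter ¬P? xs

      A! : Unique A
      A! = Unique.filter⁺ P? xs!

      B! : Unique B
      B! = Unique.filter⁺ ¬P? xs!

      A⊑ : A ⊑ xs
      A⊑ y∈ = proj₁ (∈-filter⁻ P? y∈)

      B⊑ : B ⊑ xs
      B⊑ y∈ = proj₁ (∈-filter⁻ ¬P? y∈)

      A≤ : length A ≤ n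
      A≤ = smaller P? r∈ ¬Pr

      B≤ : length B ≤ n
      B≤ = smaller ¬P? l∈ λ ¬p → ¬p Pl

      AB : ∀ {x y} → x ∈ A → y ∈ B → Edge t x y
      AB x∈ y∈ = let x∈xs , p = ∈-filter⁻ P? x∈ ; y∈xs , ¬p = ∈-filter⁻ ¬P? y∈ in
        (λ { refl → ¬p p }) , mono x∈xs y∈xs p ¬p

      both-large : Two A → Two B → Bounded xs F D
      both-large (u , u′ , u∈ , u′∈ , u≢u′) (v , v′ , v∈ , v′∈ , v≢v′) = begin
        length xs + length D                            ≡⟨ cong (_+ length D) (sym (filter-split P? xs)) ⟩
        length A + length B + length D                  ≡⟨ +-assoc (length A) (length B) (length D) ⟩
        length A + (length B + length D)                ≤⟨ +-monoˡ-≤ _ (m≤m+n (length A) (length D)) ⟩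
        (length A + length D) + (length B + length D)   ≤⟨ +-mono-≤ (ih A≤ A! goodA) (ih B≤ B! goodB) ⟩
        bound (length F′ + length D) + bound (length F′ + length D) ≤⟨ bound-double (length F′ + length D) ⟩
        bound (suc (length F′) + length D)              ≡⟨ cong (λ f → bound (f + length D)) (sym (len δ)) ⟩
        bound (length F + length D)                     ∎
        where
        open ≤-Reasoning
        t∈F : t ∈ F
        t∈F = joined-pairs (A⊑ u∈) (A⊑ u′∈) (B⊑ v∈) (B⊑ v′∈) u≢u′ v≢v′ (AB u∈ v∈) (AB u∈ v′∈) (AB u′∈ v∈) (AB u′∈ v′∈)
        F′ = proj₁ (delete t∈F)
        δ = proj₂ (delete t∈F)
        goodA : Good A F′ D
        goodA = drop-full δ (P3-free A⊑ (B⊑ v∈) (B⊑ v′∈) v≢v′ (λ y∈ → flip (AB y∈ v∈)) (λ y∈ → flip (AB y∈ v′∈)) (full g t∈F))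
          (restrict A⊑ g)
        goodB : Good B F′ D
        goodB = drop-full δ (P3-free B⊑ (A⊑ u∈) (A⊑ u′∈) u≢u′ (AB u∈) (AB u′∈) (full g t∈F)) (restrict B⊑ g)

      join : Bounded xs F D
      join with two? A A! | two? B B!
      ... | inj₂ A≤1 | _ = peel l∈ B⊑ B! (AB (∈-filter⁺ P? l∈ Pl)) B≤
        (≤-trans (≤-reflexive (sym (filter-split P? xs))) (+-monoˡ-≤ _ A≤1))
      ... | inj₁ _ | inj₂ B≤1 = peel r∈ A⊑ A! (λ y∈ → flip (AB y∈ (∈-filter⁺ ¬P? r∈ ¬Pr))) A≤
        (≤-trans (≤-reflexive (sym (filter-split P? xs))) (≤-trans (+-monoʳ-≤ _ B≤1) (≤-reflexive (+-comm _ 1))))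
      ... | inj₁ A₂ | inj₁ B₂ = both-large A₂ B₂

    open Join using (join)

    -- What is left of a Gallai partition when no class is joined to the rest in one colour. It is
    -- symmetric in s and t, so each lemma below also serves with the colours exchanged.
    record Mixed (class : V → V) (s t : C) : Set where
      field
        s≢t   : s ≢ t
        cross : ∀ {x y} → x ∈ xs → y ∈ xs → class x ≢ class y → colour x y ∈₂ (s , t)
        law   : ∀ {x y z} → x ∈ xs → y ∈ xs → z ∈ xs → class x ≡ class y → class z ≢ class x →
                colour z x ≡ colour z y
        seeₛ  : ∀ {x} → x ∈ xs → ∃ λ y → y ∈ xs × class y ≢ class x × colour x y ≡ s
        seeₜ  : ∀ {x} → x ∈ xs → ∃ λ y → y ∈ xs × class y ≢ class x × colour x y ≡ t

    exchange : ∀ {class s t} → Mixed class s t → Mixed class t s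
    exchange M = record
      { s≢t = ≢-sym s≢t
      ; cross = λ x∈ y∈ ne → case cross x∈ y∈ ne of λ { (inj₁ e) → inj₂ e ; (inj₂ e) → inj₁ e }
      ; law = law ; seeₛ = seeₜ ; seeₜ = seeₛ }
      where
      open Mixed M

    module MixedLemmas {class : V → V} {s t : C} (M : Mixed class s t) where
      open Mixed M

      apart : ∀ {x y} → class x ≢ class y → x ≢ y
      apart ne refl = ne refl

      Big : V → Set
      Big x = ∃ λ y → y ∈ xs × y ≢ x × class y ≡ class x

      -- Being part of the matching, an edge xy of colour s between classes meets no other edge of
      -- colour s. By the module law x and y are then alone in their classes, so the pair is joined
      -- to everything else in colour t.
      unlisted : ∀ {x} → x ∈ xs → ¬ Listed s → Bounded xs F D
      unlisted {x} x∈ ¬ls with seeₛ x∈ | seeₜ x∈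
      ... | y , y∈ , y≁x , xy | z , z∈ , z≁x , xz =
        join (λ w → (w ≟ x) ⊎-dec (w ≟ y)) x∈ (inj₁ refl) z∈
          (λ { (inj₁ refl) → z≁x refl ; (inj₂ refl) → s≢t (trans (sym xy) xz) })
          λ { _ w∈ (inj₁ refl) ¬w → only x∈ y∈ w∈ y≁x xy (¬w ∘ inj₁) (¬w ∘ inj₂)
            ; _ w∈ (inj₂ refl) ¬w → only y∈ x∈ w∈ (≢-sym y≁x) (trans (colour-sym y x) xy) (¬w ∘ inj₂) (¬w ∘ inj₁) }
        where
        bad : ∀ {u v w} → u ∈ xs → v ∈ xs → w ∈ xs → u ≢ v → u ≢ w → v ≢ w → colour u v ≡ s → colour u w ≡ s → ⊥
        bad u∈ v∈ w∈ uv uw vw e f = rest g u∈ v∈ w∈ uv uw vw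
          (subst (λ c → ¬ Listed c) (sym e) ¬ls) (subst (λ c → ¬ Listed c) (sym f) ¬ls)

        only : ∀ {u v w} → u ∈ xs → v ∈ xs → w ∈ xs → class v ≢ class u → colour u v ≡ s →
               w ≢ u → w ≢ v → colour u w ≡ t
        only {u} {v} {w} u∈ v∈ w∈ v≁u uv w≢u w≢v with class u ≟ class w
        ... | yes e = ⊥-elim (bad v∈ u∈ w∈ (apart v≁u) (≢-sym w≢v) (≢-sym w≢u) (trans (colour-sym v u) uv)
                        (trans (sym (law u∈ w∈ v∈ e v≁u)) (trans (colour-sym v u) uv)))
        ... | no ne = case cross u∈ w∈ ne of λ where
          (inj₁ e) → ⊥-elim (bad u∈ v∈ w∈ (≢-sym (apart v≁u)) (≢-sym w≢u) (≢-sym w≢v) uv e)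
          (inj₂ e) → e

      inside? : ∀ x y → Dec (class y ≡ class x)
      inside? x y = class y ≟ class x

      inside outside : V → List V
      inside x = filter (inside? x) xs
      outside x = filter (λ y → ¬? (inside? x y)) xs

      nbrs : C → V → List V
      nbrs c x = filter (λ y → colour x y ≟ᶜ c) (outside x)

      ∈-inside : ∀ {x y} → y ∈ inside x → y ∈ xs × class y ≡ class x
      ∈-inside {x} = ∈-filter⁻ (inside? x)

      ∈-nbrs : ∀ {c x y} → y ∈ nbrs c x → y ∈ xs × class y ≢ class x × colour x y ≡ c
      ∈-nbrs {c} {x} y∈ =
        let y∈out , e = ∈-filter⁻ (λ y → colour x y ≟ᶜ c) y∈
            y∈xs , ne = ∈-filter⁻ (λ y → ¬? (inside? x y)) y∈out
        in y∈xs , ne , e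

      nbrs-∈ : ∀ {c x y} → y ∈ xs → class y ≢ class x → colour x y ≡ c → y ∈ nbrs c x
      nbrs-∈ {c} {x} y∈ ne e = ∈-filter⁺ (λ y → colour x y ≟ᶜ c) (∈-filter⁺ (λ y → ¬? (inside? x y)) y∈ ne) e

      inside⊑ : ∀ {x} → inside x ⊑ xs
      inside⊑ y∈ = proj₁ (∈-inside y∈)

      nbrs⊑ : ∀ {c x} → nbrs c x ⊑ xs
      nbrs⊑ y∈ = proj₁ (∈-nbrs y∈)

      inside! : ∀ x → Unique (inside x)
      inside! x = Unique.filter⁺ (inside? x) xs!

      nbrs! : ∀ c x → Unique (nbrs c x)
      nbrs! c x = Unique.filter⁺ (λ y → colour x y ≟ᶜ c) (Unique.filter⁺ (λ y → ¬? (inside? x y)) xs!)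

      inside≤ : ∀ {x} → x ∈ xs → length (inside x) ≤ n
      inside≤ {x} x∈ = let y , y∈ , ne , _ = seeₛ x∈ in smaller (inside? x) y∈ ne

      nbrs≤ : ∀ {c x} → x ∈ xs → length (nbrs c x) ≤ n
      nbrs≤ {c} {x} x∈ = ≤-trans (List.length-filter (λ y → colour x y ≟ᶜ c) (outside x))
        (smaller (λ y → ¬? (inside? x y)) x∈ λ ¬p → ¬p refl)

      decompose : ∀ {x} → x ∈ xs → length xs ≤ length (inside x) + (length (nbrs s x) + length (nbrs t x))
      decompose {x} x∈ = ≤-trans (≤-reflexive (sym (filter-split (inside? x) xs)))
        (+-monoʳ-≤ (length (inside x)) (filter-cover (λ y → colour x y ≟ᶜ s) (λ y → colour x y ≟ᶜ t) (outside x)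
          λ y∈ → let y∈xs , ne = ∈-filter⁻ (λ y → ¬? (inside? x y)) y∈ in cross x∈ y∈xs (≢-sym ne)))

      joined : ∀ {c x w u} → x ∈ xs → w ∈ xs → class w ≡ class x → u ∈ nbrs c x → Edge c w u
      joined {c} {x} {w} {u} x∈ w∈ w~x u∈ with u∈xs , u≁x , xu ← ∈-nbrs u∈ =
        flip (apart (λ e → u≁x (trans e w~x)) ,
              trans (sym (law x∈ w∈ u∈xs (sym w~x) u≁x)) (trans (colour-sym u x) xu))

      from-nbrs : ∀ {c x u} → x ∈ xs → u ∈ nbrs c x → Joined c u (inside x)
      from-nbrs x∈ u∈ y∈ = flip (joined x∈ (proj₁ (∈-inside y∈)) (proj₂ (∈-inside y∈)) u∈)

      full-colour : ∀ {c x} → x ∈ xs → Big x → Two (nbrs c x) → c ∈ F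
      full-colour x∈ (x′ , x′∈ , x′≢x , x′~x) (v , v′ , v∈ , v′∈ , v≢v′) =
        joined-pairs x∈ x′∈ (nbrs⊑ v∈) (nbrs⊑ v′∈) (≢-sym x′≢x) v≢v′
          (joined x∈ x∈ refl v∈) (joined x∈ x∈ refl v′∈) (joined x∈ x′∈ x′~x v∈) (joined x∈ x′∈ x′~x v′∈)

      inside-P3 : ∀ {c x} → c ∈ F → x ∈ xs → Two (nbrs c x) → NoP3 c (inside x)
      inside-P3 c∈ x∈ (v , v′ , v∈ , v′∈ , v≢v′) =
        P3-free inside⊑ (nbrs⊑ v∈) (nbrs⊑ v′∈) v≢v′ (from-nbrs x∈ v∈) (from-nbrs x∈ v′∈) (full g c∈)

      nbrs-P3 : ∀ {c x} → c ∈ F → x ∈ xs → Big x → NoP3 c (nbrs c x)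
      nbrs-P3 c∈ x∈ (x′ , x′∈ , x′≢x , x′~x) =
        P3-free nbrs⊑ x∈ x′∈ (≢-sym x′≢x) (joined x∈ x∈ refl) (joined x∈ x′∈ x′~x) (full g c∈)

      where-is : ∀ {x y} → x ∈ xs → y ∈ xs → class y ≡ class x ⊎ y ∈ nbrs s x ⊎ y ∈ nbrs t x
      where-is {x} {y} x∈ y∈ with class y ≟ class x
      ... | yes e = inj₁ e
      ... | no ne = inj₂ (case cross x∈ y∈ (≢-sym ne) of λ where
        (inj₁ e) → inj₁ (nbrs-∈ y∈ ne e)
        (inj₂ e) → inj₂ (nbrs-∈ y∈ ne e))

      -- Were both neighbourhoods of x single vertices u and z, then u or z would see only one colour.
      two-nbrs : ∀ {x} → x ∈ xs → length (nbrs s x) ≤ 1 → Two (nbrs t x)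
      two-nbrs {x} x∈ s≤1 with two? (nbrs t x) (nbrs! t x)
      ... | inj₁ two = two
      ... | inj₂ t≤1 with seeₛ x∈ | seeₜ x∈
      ... | u , u∈ , u≁x , xu | z , z∈ , z≁x , xz with seeₛ z∈ | seeₜ u∈
      ... | y , y∈ , y≁z , zy | w , w∈ , w≁u , uw =
        ⊥-elim (case where-is x∈ y∈ of λ where
          (inj₁ e) → s≢t (trans (sym zy) (trans (sym (law x∈ y∈ z∈ (sym e) z≁x)) (trans (colour-sym z x) xz)))
          (inj₂ (inj₂ y∈t)) → y≁z (cong class (¬Two⇒≡ t≤1 y∈t z∈t))
          (inj₂ (inj₁ y∈s)) → case where-is x∈ w∈ of λ where
            (inj₁ e) → s≢t (trans (sym xu) (trans (colour-sym x u) (trans (law x∈ w∈ u∈ (sym e) u≁x) uw)))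
            (inj₂ (inj₁ w∈s)) → w≁u (cong class (¬Two⇒≡ s≤1 w∈s u∈s))
            (inj₂ (inj₂ w∈t)) → s≢t (trans (sym zy) (trans (cong (colour z) (¬Two⇒≡ s≤1 y∈s u∈s))
              (trans (colour-sym z u) (trans (cong (colour u) (¬Two⇒≡ t≤1 z∈t w∈t)) uw)))))
        where
        u∈s = nbrs-∈ {s} {x} u∈ u≁x xu
        z∈t = nbrs-∈ {t} {x} z∈ z≁x xz

      -- The class X of x has a single s-neighbour u. There are two t-neighbours, so t becomes a
      -- matching both in X and in the t-neighbourhood. The vertex u is charged to X: as u is joined
      -- to X in s, that colour weakens there as well, and this makes room for one more vertex.
      thin : ∀ {x} → x ∈ xs → Big x → Listed s → length (nbrs s x) ≤ 1 → Bounded xs F D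
      thin {x} x∈ big ls s≤1 = go ls
        where
        open ≤-Reasoning
        two = two-nbrs x∈ s≤1
        t∈F = full-colour x∈ big two
        F′ = proj₁ (delete t∈F)
        δ = proj₂ (delete t∈F)
        u∈ : ∃ λ u → u ∈ nbrs s x
        u∈ = let u , u∈xs , ne , e = seeₛ x∈ in u , nbrs-∈ u∈xs ne e
        X = length (inside x)
        T = length (nbrs t x)
        d = length D
        goodX : Good (inside x) F′ D
        goodX = drop-full δ (inside-P3 t∈F x∈ two) (restrict inside⊑ g)
        boundT : T + d ≤ bound (length F′ + d)
        boundT = ih (nbrs≤ x∈) (nbrs! t x) (drop-full δ (nbrs-P3 t∈F x∈ big) (restrict nbrs⊑ g))
        sizes : length xs + d ≤ suc X + (T + d)
        sizes = begin
          length xs + d                       ≤⟨ +-monoˡ-≤ d (decompose x∈) ⟩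
          X + (length (nbrs s x) + T) + d     ≤⟨ +-monoˡ-≤ d (+-monoʳ-≤ X (+-monoˡ-≤ T s≤1)) ⟩
          X + suc T + d                       ≡⟨ cong (_+ d) (+-suc X T) ⟩
          suc (X + T) + d                     ≡⟨ cong suc (+-assoc X T d) ⟩
          suc X + (T + d)                     ∎

        finish : suc X ≤ bound (length F′ + d) → Bounded xs F D
        finish X≤ = begin
          length xs + d                                     ≤⟨ sizes ⟩
          suc X + (T + d)                                   ≤⟨ +-mono-≤ X≤ boundT ⟩
          bound (length F′ + d) + bound (length F′ + d)     ≤⟨ bound-double (length F′ + d) ⟩
          bound (suc (length F′) + d)                       ≡⟨ cong (λ f → bound (f + d)) (sym (len δ)) ⟩
          bound (length F + d)                              ∎

        go : Listed s → Bounded xs F D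
        go (inj₂ s∈D) with D′ , ε ← delete s∈D = finish (begin
          suc X                               ≤⟨ s≤s (≤-trans (m≤m+n X (length D′)) (ih (inside≤ x∈) (inside! x)
                                                  (drop-cyc ε (P3-free′ inside⊑ (nbrs⊑ (proj₂ u∈)) (from-nbrs x∈ (proj₂ u∈)) (cyc g s∈D)) goodX))) ⟩
          suc (bound (length F′ + length D′))  ≤⟨ ≤-trans (n≤1+n _) (bound+2 (length F′ + length D′)) ⟩
          bound (suc (length F′ + length D′)) ≡⟨ cong bound (sym (+-suc (length F′) (length D′))) ⟩
          bound (length F′ + suc (length D′)) ≡⟨ cong (λ m → bound (length F′ + m)) (sym (len ε)) ⟩
          bound (length F′ + d)               ∎)
        go (inj₁ s∈F) with cover δ s∈F
        ... | inj₁ e = ⊥-elim (s≢t e)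
        ... | inj₂ s∈F′ with F″ , ε ← delete s∈F′ = finish (begin
          suc X                               ≤⟨ s≤s (m≤m+n X d) ⟩
          suc (X + d)                         ≡⟨ sym (+-suc X d) ⟩
          X + length (s ∷ D)                  ≤⟨ ih (inside≤ x∈) (inside! x)
                                                  (weaken-full ε (C4-free inside⊑ (nbrs⊑ (proj₂ u∈)) (from-nbrs x∈ (proj₂ u∈)) (full g s∈F)) goodX) ⟩
          bound (length F″ + suc d)           ≡⟨ cong bound (+-suc (length F″) d) ⟩
          bound (suc (length F″) + d)         ≡⟨ cong (λ f → bound (f + d)) (sym (len ε)) ⟩
          bound (length F′ + d)               ∎)

      big? : ∀ x → Dec (Big x)
      big? x with any? (λ y → ¬? (y ≟ x) ×-dec inside? x y) xs
      ... | yes p = let y , y∈ , q = find p in yes (y , y∈ , q)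
      ... | no ¬p = no λ (y , y∈ , q) → ¬p (lose y∈ q)

      -- Colour s is a matching in nbrs s x, so a class of nbrs s x with at least two vertices is joined by t to
      -- the rest of nbrs s x; hence t is a matching in this rest as well as in the class.
      nbrs-bound : ∀ {x F″} → (∀ {y} → y ∈ xs → Big y → Two (nbrs t y)) → s ∈ F → t ∈ F →
        (∀ {ys} → ys ⊑ xs → NoP3 s ys → NoP3 t ys → Good ys F″ D) → x ∈ xs → Big x →
        length (nbrs s x) ≤ bound (length F″ + length D) + bound (length F″ + length D)
      nbrs-bound {x} {F″} thick s∈F t∈F good x∈ big@(x′ , x′∈ , x′≢x , x′~x) with any? big? (nbrs s x)
      -- No two vertices of the neighbourhood share a class, so only s and t occur in it. As s is a
      -- matching there, t alone is listed, and `bound` 1 = 2 + 2.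
      ... | no ¬big = ≤-trans (≤-trans (m≤m+n _ 0) (ih {F = t ∷ []} {D = []} (nbrs≤ x∈) (nbrs! s x) good₁))
              (+-mono-≤ (2≤bound (length F″ + length D)) (2≤bound (length F″ + length D)))
        where
        single : ∀ {y z} → y ∈ nbrs s x → z ∈ nbrs s x → y ≢ z → class y ≢ class z
        single y∈ z∈ y≢z e = ¬big (lose z∈ (_ , nbrs⊑ y∈ , y≢z , e))

        coloured-s : ∀ {y z} → y ∈ nbrs s x → z ∈ nbrs s x → y ≢ z →
          ¬ (colour y z ∈ t ∷ [] ⊎ colour y z ∈ []) → Edge s y z
        coloured-s y∈ z∈ y≢z ¬t = y≢z , (case cross (nbrs⊑ y∈) (nbrs⊑ z∈) (single y∈ z∈ y≢z) of λ where
          (inj₁ e) → e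
          (inj₂ e) → ⊥-elim (¬t (inj₁ (here e))))

        good₁ : Good (nbrs s x) (t ∷ []) []
        good₁ = record
          { full = λ { (here refl) → full (restrict nbrs⊑ g) t∈F }
          ; cyc = λ ()
          ; rest = λ u∈ v∈ w∈ uv uw vw p q → nbrs-P3 s∈F x∈ big u∈ v∈ w∈
              (coloured-s u∈ v∈ uv p) (coloured-s u∈ w∈ uw q) vw }
      ... | yes p with find p
      ... | y , y∈ , y′ , y′∈ , y′≢y , y′~y = ≤-trans (≤-reflexive (sym (filter-split (inside? y) A)))
          (+-mono-≤ (≤-trans (m≤m+n (length Y) (length D)) (ih (≤-trans (List.length-filter (inside? y) A) (nbrs≤ x∈)) (Unique.filter⁺ (inside? y) (nbrs! s x)) goodY))
                    (≤-trans (m≤m+n (length Z) (length D)) (ih (≤-trans (List.length-filter ¬inside? A) (nbrs≤ x∈)) (Unique.filter⁺ ¬inside? (nbrs! s x)) goodZ)))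
        where
        ¬inside? = λ z → ¬? (inside? y z)
        A = nbrs s x
        Y = filter (inside? y) A
        Z = filter ¬inside? A
        y∈xs = nbrs⊑ {s} {x} y∈

        ∈Y : ∀ {z} → z ∈ Y → z ∈ A × class z ≡ class y
        ∈Y = ∈-filter⁻ (inside? y)
        ∈Z : ∀ {z} → z ∈ Z → z ∈ A × class z ≢ class y
        ∈Z = ∈-filter⁻ ¬inside?

        P3-A : NoP3 s A
        P3-A = nbrs-P3 s∈F x∈ big

        y′∈A : y′ ∈ A
        y′∈A = let _ , y≁x , xy = ∈-nbrs y∈ in nbrs-∈ y′∈ (λ e → y≁x (trans (sym y′~y) e))
          (trans (sym (law y∈xs y′∈ x∈ (sym y′~y) (≢-sym y≁x))) xy)

        goodY : Good Y F″ D
        goodY = good (λ z∈ → nbrs⊑ (proj₁ (∈Y z∈)))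
          (λ u∈ v∈ w∈ → P3-A (proj₁ (∈Y u∈)) (proj₁ (∈Y v∈)) (proj₁ (∈Y w∈)))
          (λ u∈ v∈ w∈ → inside-P3 t∈F y∈xs (thick y∈xs (y′ , y′∈ , y′≢y , y′~y)) (in-y u∈) (in-y v∈) (in-y w∈))
          where
          in-y : ∀ {z} → z ∈ Y → z ∈ inside y
          in-y z∈ = ∈-filter⁺ (inside? y) (nbrs⊑ (proj₁ (∈Y z∈))) (proj₂ (∈Y z∈))

        to-Z : ∀ {z} → z ∈ Z → colour z y ≡ t × colour z y′ ≡ t
        to-Z {z} z∈ with z∈A , z≁y ← ∈Z z∈ = case cross (nbrs⊑ z∈A) y∈xs z≁y of λ where
            (inj₁ e) → ⊥-elim (P3-A z∈A y∈ y′∈A (apart z≁y , e) (z≢y′ , trans (sym same) e) (≢-sym y′≢y))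
            (inj₂ e) → e , trans (sym same) e
          where
          same = law y∈xs y′∈ (nbrs⊑ {s} {x} z∈A) (sym y′~y) z≁y
          z≢y′ = apart {z} {y′} λ e → z≁y (trans e y′~y)

        goodZ : Good Z F″ D
        goodZ = good Z⊑
          (λ u∈ v∈ w∈ → P3-A (proj₁ (∈Z u∈)) (proj₁ (∈Z v∈)) (proj₁ (∈Z w∈)))
          (P3-free Z⊑ y∈xs y′∈ (≢-sym y′≢y)
            (λ z∈ → flip (apart (proj₂ (∈Z z∈)) , proj₁ (to-Z z∈)))
            (λ z∈ → flip (apart (λ e → proj₂ (∈Z z∈) (trans e y′~y)) , proj₂ (to-Z z∈)))
            (full g t∈F))
          where
          Z⊑ : Z ⊑ xs
          Z⊑ z∈ = nbrs⊑ (proj₁ (∈Z z∈))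

    -- Both colours lie in F and turn into matchings. With K the bound for two colours fewer, the
    -- class of x together with D contributes at most K and each of the two neighbourhoods at most
    -- 2K, in total 5K.
    thick : ∀ {class s t x} (M : Mixed class s t) → x ∈ xs → MixedLemmas.Big M x →
      (∀ {y} → y ∈ xs → MixedLemmas.Big M y → Two (MixedLemmas.nbrs M s y)) → (∀ {y} → y ∈ xs → MixedLemmas.Big M y → Two (MixedLemmas.nbrs M t y)) → Bounded xs F D
    thick {class} {s} {t} {x} M x∈ big twoₛ twoₜ = begin
      length xs + d                             ≤⟨ +-monoˡ-≤ d (decompose x∈) ⟩
      X + (S + T) + d                           ≡⟨ +-assoc X (S + T) d ⟩
      X + (S + T + d)                           ≡⟨ cong (X +_) (+-comm (S + T) d) ⟩
      X + (d + (S + T))                         ≡⟨ sym (+-assoc X d (S + T)) ⟩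
      (X + d) + (S + T)                         ≤⟨ +-mono-≤ X≤ (+-mono-≤ S≤ T≤) ⟩
      K + ((K + K) + (K + K))                   ≡⟨ cong (K +_) (+-assoc K K (K + K)) ⟩
      K + (K + (K + (K + K)))                   ≡⟨ cong (λ z → K + (K + (K + (K + z)))) (sym (+-identityʳ K)) ⟩
      5 * K                                     ≤⟨ bound-five (length F″ + d) ⟩
      bound (suc (suc (length F″)) + d)         ≡⟨ cong (λ f → bound (suc f + d)) (sym (len ε)) ⟩
      bound (suc (length F′) + d)               ≡⟨ cong (λ f → bound (f + d)) (sym (len δ)) ⟩
      bound (length F + d)                      ∎
      where
      open ≤-Reasoning
      open Mixed M using (s≢t)
      open MixedLemmas M
      d = length D
      X = length (inside x)
      S = length (nbrs s x)
      T = length (nbrs t x)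
      s∈F : s ∈ F
      s∈F = full-colour x∈ big (twoₛ x∈ big)
      t∈F : t ∈ F
      t∈F = full-colour x∈ big (twoₜ x∈ big)
      F′ = proj₁ (delete s∈F)
      δ = proj₂ (delete s∈F)
      t∈F′ : t ∈ F′
      t∈F′ = case cover δ t∈F of λ { (inj₁ e) → ⊥-elim (s≢t (sym e)) ; (inj₂ t∈) → t∈ }
      F″ = proj₁ (delete t∈F′)
      ε = proj₂ (delete t∈F′)
      K = bound (length F″ + d)
      good : ∀ {ys} → ys ⊑ xs → NoP3 s ys → NoP3 t ys → Good ys F″ D
      good ys⊑ p q = drop-full ε q (drop-full δ p (restrict ys⊑ g))
      X≤ : X + d ≤ K
      X≤ = ih (inside≤ x∈) (inside! x) (good inside⊑ (inside-P3 s∈F x∈ (twoₛ x∈ big)) (inside-P3 t∈F x∈ (twoₜ x∈ big)))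
      S≤ : S ≤ K + K
      S≤ = nbrs-bound twoₜ s∈F t∈F good x∈ big
      T≤ : T ≤ K + K
      T≤ = MixedLemmas.nbrs-bound (exchange M) twoₛ t∈F s∈F (λ ys⊑ p q → good ys⊑ q p) x∈ big

    mixed : ∀ {class s t x} → x ∈ xs → Mixed class s t → Bounded xs F D
    mixed {class} {s} {t} {x} x∈ M with listed? s | listed? t
    ... | no ¬ls | _ = unlisted x∈ ¬ls
      where
      open MixedLemmas M
    ... | yes _ | no ¬lt = unlisted x∈ ¬lt
      where
      open MixedLemmas (exchange M)
    ... | yes ls | yes lt = by-thin (any? (thin? s) xs) (any? (thin? t) xs)
      where
      open Mixed M
      open MixedLemmas M
      Thin : C → V → Set
      Thin c x = Big x × length (nbrs c x) ≤ 1

      thin? : ∀ c x → Dec (Thin c x)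
      thin? c x = big? x ×-dec (length (nbrs c x) ≤? 1)

      enough : ∀ {c} → ¬ Any (Thin c) xs → ∀ {y} → y ∈ xs → Big y → Two (nbrs c y)
      enough {c} ¬thin {y} y∈ big = case two? (nbrs c y) (nbrs! c y) of λ where
        (inj₁ two) → two
        (inj₂ ≤1) → ⊥-elim (¬thin (lose y∈ (big , ≤1)))

      by-thin : Dec (Any (Thin s) xs) → Dec (Any (Thin t) xs) → Bounded xs F D
      by-thin (yes p) _ = let _ , y∈ , big , ≤1 = find p in thin y∈ big ls ≤1
      by-thin (no _) (yes p) = let _ , y∈ , big , ≤1 = find p in MixedLemmas.thin (exchange M) y∈ big lt ≤1
      by-thin (no ¬s) (no ¬t) with any? big? xs
      ... | yes p = let _ , y∈ , big = find p in thick M y∈ big (enough ¬s) (enough ¬t)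
      -- All classes are single vertices, so only s and t occur.
      ... | no ¬big = two-coloured xs! s≢t g ls lt λ y∈ z∈ y≢z → cross y∈ z∈ λ e → ¬big (lose z∈ (_ , y∈ , y≢z , e))

    -- By the module law the whole class of x sees outside itself what x sees, so the cut around
    -- this class has one colour.
    one-colour : ∀ {x y c} (class : V → V) →
      (∀ {x y z} → x ∈ xs → y ∈ xs → z ∈ xs → class x ≡ class y → class z ≢ class x → colour z x ≡ colour z y) →
      x ∈ xs → y ∈ xs → class y ≢ class x →
      (∀ {z} → z ∈ xs → class z ≢ class x → colour x z ≡ c) → Bounded xs F D
    one-colour {x} class law x∈ y∈ y≁x mono = join (λ z → class z ≟ class x) x∈ refl y∈ y≁x
      λ {u} {v} u∈ v∈ u~x v≁x → trans (colour-sym u v)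
        (trans (sym (law x∈ u∈ v∈ (sym u~x) v≁x)) (trans (colour-sym v x) (mono v∈ v≁x)))

    step : 2 ≤ length xs → Bounded xs F D
    step 2≤ with gallai xs! 2≤
    ... | P = by-colours (a ≟ᶜ b) (any? (λ x → ¬? (sees? a x)) xs) (any? (λ x → ¬? (sees? b x)) xs)
      where
      open Partition P
      a = proj₁ ab
      b = proj₂ ab

      Sees : C → V → Set
      Sees c x = ∃ λ y → y ∈ xs × class y ≢ class x × colour x y ≡ c

      sees? : ∀ c x → Dec (Sees c x)
      sees? c x with any? (λ y → ¬? (class y ≟ class x) ×-dec (colour x y ≟ᶜ c)) xs
      ... | yes p = let y , y∈ , q = find p in yes (y , y∈ , q)
      ... | no ¬p = no λ (y , y∈ , q) → ¬p (lose y∈ q)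

      other : ∀ x → ∃ λ y → y ∈ xs × class y ≢ class x
      other x with class left ≟ class x
      ... | yes e = right , right∈ , λ f → proper (trans e (sym f))
      ... | no ne = left , left∈ , ne

      all-see : ∀ {c} → ¬ Any (λ x → ¬ Sees c x) xs → ∀ {x} → x ∈ xs → Sees c x
      all-see {c} ¬p {x} x∈ = decidable-stable (sees? c x) λ ¬s → ¬p (lose x∈ ¬s)

      by-colours : Dec (a ≡ b) → Dec (Any (λ x → ¬ Sees a x) xs) → Dec (Any (λ x → ¬ Sees b x) xs) → Bounded xs F D
      by-colours (yes a≡b) _ _ = one-colour class module-law left∈ right∈ (≢-sym proper)
        λ z∈ ne → case cross left∈ z∈ (≢-sym ne) of λ { (inj₁ e) → e ; (inj₂ e) → trans e (sym a≡b) }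
      by-colours (no _) (yes p) _ with x , x∈ , ¬s ← find p =
        let y , y∈ , ne = other x in one-colour class module-law x∈ y∈ ne
          λ z∈ z≁x → case cross x∈ z∈ (≢-sym z≁x) of λ { (inj₁ e) → ⊥-elim (¬s (_ , z∈ , z≁x , e)) ; (inj₂ e) → e }
      by-colours (no _) (no _) (yes p) with x , x∈ , ¬s ← find p =
        let y , y∈ , ne = other x in one-colour class module-law x∈ y∈ ne
          λ z∈ z≁x → case cross x∈ z∈ (≢-sym z≁x) of λ { (inj₁ e) → e ; (inj₂ e) → ⊥-elim (¬s (_ , z∈ , z≁x , e)) }
      by-colours (no a≢b) (no ¬a) (no ¬b) = mixed left∈ record
        { s≢t = a≢b ; cross = cross ; law = module-law ; seeₛ = all-see ¬a ; seeₜ = all-see ¬b }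

  bounded : ∀ n {xs F D} → length xs ≤ n → Unique xs → Good xs F D → Bounded xs F D
  bounded n {xs} {F} {D} xs≤ xs! g with 2 ≤? length xs
  ... | no 2≰ = ≤-trans (+-mono-≤ (≤-trans (≤-pred (≰⇒> 2≰)) (n≤1+n 1)) (m≤n+m (length D) (length F)))
                  (k+2≤bound (length F + length D))
  bounded zero xs≤ _ _ | yes 2≤ with () ← ≤-trans 2≤ xs≤
  bounded (suc n) xs≤ xs! g | yes 2≤ = Induction.step n (bounded n) xs≤ xs! g 2≤

-- Decision procedures for wheels and rainbow triangles.

monoW5? : ∀ {m k} (c : Colouring m k) → Dec (MonoW5 c)
monoW5? {m} {k} c = map′
  (λ { (x , h , v0 , h0 , v1 , h1 , e01 , v2 , h2 , e12 , n02 , v3 , h3 , e23 , e30 , n13) →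
       x , h , v0 , v1 , v2 , v3 ,
       (proj₁ h0 , proj₁ h1 , proj₁ h2 , proj₁ h3 , proj₁ e01 , n02 , ≢-sym (proj₁ e30) , proj₁ e12 , n13 , proj₁ e23) ,
       (proj₂ e01 , proj₂ e12 , proj₂ e23 , proj₂ e30 , proj₂ h0 , proj₂ h1 , proj₂ h2 , proj₂ h3) })
  (λ { (x , h , v0 , v1 , v2 , v3 ,
       (h≢0 , h≢1 , h≢2 , h≢3 , n01 , n02 , n03 , n12 , n13 , n23) , (c01 , c12 , c23 , c30 , ch0 , ch1 , ch2 , ch3)) →
       x , h , v0 , (h≢0 , ch0) , v1 , (h≢1 , ch1) , (n01 , c01) , v2 , (h≢2 , ch2) , (n12 , c12) , n02 ,
       v3 , (h≢3 , ch3) , (n23 , c23) , (≢-sym n03 , c30) , n13 })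
  -- The edge tests stand between the quantifiers, so that a failing choice is abandoned before the
  -- next vertex is tried; this shortens the evaluation for K₁₄.
  (Fin.any? λ x → Fin.any? λ h → Fin.any? λ v0 → edge? x h v0 ×-dec
   Fin.any? λ v1 → edge? x h v1 ×-dec (edge? x v0 v1 ×-dec
   Fin.any? λ v2 → edge? x h v2 ×-dec (edge? x v1 v2 ×-dec (¬? (v0 Fin.≟ v2) ×-dec
   Fin.any? λ v3 → edge? x h v3 ×-dec (edge? x v2 v3 ×-dec (edge? x v3 v0 ×-dec ¬? (v1 Fin.≟ v3)))))))
  where
  edge? : ∀ x (u v : Fin m) → Dec (u ≢ v × col c u v ≡ x)
  edge? x u v = ¬? (u Fin.≟ v) ×-dec (col c u v Fin.≟ x)

rainbow? : ∀ {m k} (c : Colouring m k) → Dec (RainbowK3 c)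
rainbow? c = Fin.any? λ a → Fin.any? λ b → Fin.any? λ d →
  (¬? (a Fin.≟ b) ×-dec (¬? (b Fin.≟ d) ×-dec ¬? (a Fin.≟ d))) ×-dec
  (¬? (col c a b Fin.≟ col c b d) ×-dec (¬? (col c b d Fin.≟ col c a d) ×-dec ¬? (col c a b Fin.≟ col c a d)))

-- The lower bound

Avoiding : ℕ → ℕ → Set
Avoiding k m = Σ (Colouring m k) λ c → ¬ RainbowK3 c × ¬ MonoW5 c

avoiding⇒¬arrows : ∀ {k m n} → Avoiding k n → m ≤ n → ¬ Arrows k m
avoiding⇒¬arrows {k} {m} {n} (c , no-rainbow , no-W5) m≤n arrows = case arrows c′ of λ where
    (inj₁ (a , b , d , (ab , bd , ad) , q)) → no-rainbow (ι a , ι b , ι d , (inj ab , inj bd , inj ad) , q)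
    (inj₂ (x , h , v0 , v1 , v2 , v3 , (p , q , r , s , t , u , v , w , y , z) , e)) →
      no-W5 (x , ι h , ι v0 , ι v1 , ι v2 , ι v3 ,
        (inj p , inj q , inj r , inj s , inj t , inj u , inj v , inj w , inj y , inj z) , e)
  where
  ι : Fin m → Fin n
  ι i = Fin.inject≤ i m≤n
  inj : ∀ {i j} → i ≢ j → ι i ≢ ι j
  inj i≢j e = i≢j (Fin.inject≤-injective m≤n m≤n _ _ e)
  c′ : Colouring m k
  c′ = record { col = λ i j → col c (ι i) (ι j) ; sym = λ i j → Colouring.sym c (ι i) (ι j) }

-- The difference is not reduced modulo n, so a list of differences has to contain n - d along with
-- d to be invariant under rotation.
circulant : ∀ n {k} → (ℕ → Fin k) → Colouring n k
circulant n f = record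
  { col = λ i j → f ∣ toℕ i - toℕ j ∣
  ; sym = λ i j → cong f (∣-∣-comm (toℕ i) (toℕ j)) }

no-rainbow₁ : ∀ {m} (c : Colouring m 1) → ¬ RainbowK3 c
no-rainbow₁ c (a , b , d , _ , ne , _) with col c a b | col c b d
... | zero | zero = ne refl

no-rainbow₂ : ∀ {m} (c : Colouring m 2) → ¬ RainbowK3 c
no-rainbow₂ c (a , b , d , _ , p , q , r) with col c a b | col c b d | col c a d
... | zero | zero | _ = p refl
... | suc zero | suc zero | _ = p refl
... | zero | suc zero | zero = r refl
... | zero | suc zero | suc zero = q refl
... | suc zero | zero | zero = q refl
... | suc zero | zero | suc zero = r refl

NoMonoTriangle : ∀ {m k} → Colouring m k → Set
NoMonoTriangle c = ∀ x a b d → a ≢ b → b ≢ d → a ≢ d → col c a b ≡ x → col c b d ≡ x → col c a d ≡ x → ⊥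

-- The lexicographic product: each vertex of o becomes a copy of c, and the two colourings use
-- disjoint sets of colours.
module Substitution {p q m k : ℕ} (o : Colouring p q) (c : Colouring m k) where

  block : Fin (p * m) → Fin p
  block u = proj₁ (Fin.remQuot {p} m u)

  pos : Fin (p * m) → Fin m
  pos u = proj₂ (Fin.remQuot {p} m u)

  block-pos : ∀ {u v} → block u ≡ block v → pos u ≡ pos v → u ≡ v
  block-pos {u} {v} e f = trans (sym (Fin.combine-remQuot {p} m u)) (trans (cong₂ Fin.combine e f) (Fin.combine-remQuot {p} m v))

  col⁺ : Fin (p * m) → Fin (p * m) → Fin (q + k)
  col⁺ u v with block u Fin.≟ block v
  ... | yes _ = q Fin.↑ʳ col c (pos u) (pos v)
  ... | no _  = col o (block u) (block v) Fin.↑ˡ k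

  col⁺-sym : ∀ u v → col⁺ u v ≡ col⁺ v u
  col⁺-sym u v with block u Fin.≟ block v | block v Fin.≟ block u
  ... | yes _ | yes _ = cong (q Fin.↑ʳ_) (Colouring.sym c (pos u) (pos v))
  ... | yes e | no ne = ⊥-elim (ne (sym e))
  ... | no ne | yes e = ⊥-elim (ne (sym e))
  ... | no _ | no _ = cong (Fin._↑ˡ k) (Colouring.sym o (block u) (block v))

  substituted : Colouring (p * m) (q + k)
  substituted = record { col = col⁺ ; sym = col⁺-sym }

  ↑ˡ≢↑ʳ : ∀ {i : Fin q} {j : Fin k} → i Fin.↑ˡ k ≢ q Fin.↑ʳ j
  ↑ˡ≢↑ʳ {i} {j} e with () ← trans (sym (Fin.splitAt-↑ˡ q i k)) (trans (cong (Fin.splitAt q) e) (Fin.splitAt-↑ʳ q k j))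

  outer-edge : ∀ {u v i} → col⁺ u v ≡ i Fin.↑ˡ k → block u ≢ block v × col o (block u) (block v) ≡ i
  outer-edge {u} {v} e with block u Fin.≟ block v
  ... | yes _ = ⊥-elim (↑ˡ≢↑ʳ (sym e))
  ... | no ne = ne , Fin.↑ˡ-injective k _ _ e

  inner-edge : ∀ {u v j} → col⁺ u v ≡ q Fin.↑ʳ j → block u ≡ block v × col c (pos u) (pos v) ≡ j
  inner-edge {u} {v} e with block u Fin.≟ block v
  ... | yes f = f , Fin.↑ʳ-injective q _ _ e
  ... | no _ = ⊥-elim (↑ˡ≢↑ʳ e)

  -- If exactly two of the vertices share a block, their edges to the third have the same colour.
  no-rainbow⁺ : ¬ RainbowK3 o → ¬ RainbowK3 c → ¬ RainbowK3 substituted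
  no-rainbow⁺ no-o no-c (a , b , d , (ab , bd , ad) , (x , y , z))
    with block a Fin.≟ block b | block b Fin.≟ block d | block a Fin.≟ block d
  ... | yes e | yes f | yes g = no-c (pos a , pos b , pos d ,
        (ab ∘ block-pos e , bd ∘ block-pos f , ad ∘ block-pos g) ,
        (x ∘ cong (q Fin.↑ʳ_) , y ∘ cong (q Fin.↑ʳ_) , z ∘ cong (q Fin.↑ʳ_)))
  ... | no e | no f | no g = no-o (block a , block b , block d , (e , f , g) ,
        (x ∘ cong (Fin._↑ˡ k) , y ∘ cong (Fin._↑ˡ k) , z ∘ cong (Fin._↑ˡ k)))
  ... | yes e | no _ | no _ = y (cong (λ β → col o β (block d) Fin.↑ˡ k) (sym e))
  ... | no _ | yes f | no _ = z (cong (λ β → col o (block a) β Fin.↑ˡ k) f)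
  ... | no _ | no _ | yes g = x (cong (Fin._↑ˡ k) (trans (Colouring.sym o (block a) (block b)) (cong (col o (block b)) g)))
  ... | yes e | yes f | no g = g (trans e f)
  ... | yes e | no f | yes g = f (trans (sym e) g)
  ... | no e | yes f | yes g = e (trans g (sym f))

  -- In an outer colour, the hub and two consecutive rim vertices give a monochromatic triangle of
  -- o. In an inner colour, the spokes keep the whole wheel within one block.
  no-W5⁺ : NoMonoTriangle o → ¬ MonoW5 c → ¬ MonoW5 substituted
  no-W5⁺ no-o no-c (x , h , v0 , v1 , v2 , v3 , (n₁ , n₂ , n₃ , n₄ , n₅ , n₆ , n₇ , n₈ , n₉ , n₀) , (e01 , e12 , e23 , e30 , eh0 , eh1 , eh2 , eh3))
    with Fin.splitAt q x in eq
  ... | inj₁ i = no-o i _ _ _ (proj₁ (out eh0)) (proj₁ (out e01)) (proj₁ (out eh1))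
                   (proj₂ (out eh0)) (proj₂ (out e01)) (proj₂ (out eh1))
    where
    out : ∀ {u v} → col⁺ u v ≡ x → block u ≢ block v × col o (block u) (block v) ≡ i
    out e = outer-edge (trans e (sym (Fin.splitAt⁻¹-↑ˡ eq)))
  ... | inj₂ j = no-c (j , pos h , pos v0 , pos v1 , pos v2 , pos v3 ,
        (apart n₁ h0 , apart n₂ h1 , apart n₃ h2 , apart n₄ h3 , apart n₅ (via h0 h1) , apart n₆ (via h0 h2) ,
         apart n₇ (via h0 h3) , apart n₈ (via h1 h2) , apart n₉ (via h1 h3) , apart n₀ (via h2 h3)) ,
        (proj₂ (inn e01) , proj₂ (inn e12) , proj₂ (inn e23) , proj₂ (inn e30) ,
         proj₂ (inn eh0) , proj₂ (inn eh1) , proj₂ (inn eh2) , proj₂ (inn eh3)))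
    where
    inn : ∀ {u v} → col⁺ u v ≡ x → block u ≡ block v × col c (pos u) (pos v) ≡ j
    inn e = inner-edge (trans e (sym (Fin.splitAt⁻¹-↑ʳ eq)))
    h0 = proj₁ (inn eh0)
    h1 = proj₁ (inn eh1)
    h2 = proj₁ (inn eh2)
    h3 = proj₁ (inn eh3)
    via : ∀ {u v} → block h ≡ block u → block h ≡ block v → block u ≡ block v
    via e f = trans (sym e) f
    apart : ∀ {u v} → u ≢ v → block u ≡ block v → pos u ≢ pos v
    apart ne e f = ne (block-pos e f)

substitute : ∀ {p q m k} (o : Colouring p q) → ¬ RainbowK3 o → NoMonoTriangle o → Avoiding k m → Avoiding (q + k) (p * m)
substitute o no-o tri (c , no-c , no-w) = substituted , no-rainbow⁺ no-o no-c , no-W5⁺ tri no-w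
  where
  open Substitution o c

two-colour : List ℕ → ℕ → Fin 2
two-colour ds d = if does (any? (d ℕ.≟_) ds) then zero else suc zero

pentagon : Colouring 5 2
pentagon = circulant 5 (two-colour (1 ∷ 4 ∷ []))

noMonoTriangle? : ∀ {m k} (c : Colouring m k) → Dec (NoMonoTriangle c)
noMonoTriangle? c = Fin.all? λ x → Fin.all? λ a → Fin.all? λ b → Fin.all? λ d →
  ¬? (a Fin.≟ b) →-dec (¬? (b Fin.≟ d) →-dec (¬? (a Fin.≟ d) →-dec ((col c a b Fin.≟ x) →-dec
  ((col c b d Fin.≟ x) →-dec ((col c a d Fin.≟ x) →-dec no λ ())))))

K₂ : Colouring 2 1
K₂ = circulant 2 λ _ → zero

avoiding-1 : Avoiding 1 4
avoiding-1 = c , no-rainbow₁ c , toWitnessFalse {a? = monoW5? c} tt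
  where c = circulant 4 λ _ → zero

-- The Cayley colouring of ℤ/14 whose first colour has the differences ±1, ±2, ±6.
avoiding-2 : Avoiding 2 14
avoiding-2 = c , no-rainbow₂ c , toWitnessFalse {a? = monoW5? c} tt
  where c = circulant 14 (two-colour (1 ∷ 2 ∷ 6 ∷ 8 ∷ 12 ∷ 13 ∷ []))

times-five : ∀ m j → 5 * (m * 5 ^ j) ≡ m * 5 ^ suc j
times-five m j = trans (sym (*-assoc 5 m (5 ^ j))) (trans (cong (_* 5 ^ j) (*-comm 5 m)) (*-assoc m 5 (5 ^ j)))

iterate : ∀ {k m} → Avoiding k m → ∀ j → Avoiding (k + 2 * j) (m * 5 ^ j)
iterate {k} {m} A zero = subst₂ Avoiding (sym (+-identityʳ k)) (sym (*-identityʳ m)) A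
iterate {k} {m} A (suc j) = subst₂ Avoiding colours (times-five m j)
  (substitute pentagon (no-rainbow₂ pentagon) (toWitness {a? = noMonoTriangle? pentagon} tt) (iterate A j))
  where
  colours : 2 + (k + 2 * j) ≡ k + 2 * suc j
  colours = trans (sym (+-assoc 2 k (2 * j))) (trans (cong (_+ 2 * j) (+-comm 2 k))
    (trans (+-assoc k 2 (2 * j)) (cong (k +_) (sym (*-suc 2 j)))))

avoiding-3 : Avoiding 3 28
avoiding-3 = substitute K₂ (no-rainbow₁ K₂) (toWitness {a? = noMonoTriangle? K₂} tt) avoiding-2

-- The two bounds combined.

arrows : ∀ k n → bound k < n → Arrows k n
arrows k n bound<n c with rainbow? c | monoW5? c
... | yes rainbow | _ = inj₁ rainbow
... | no _ | yes w5 = inj₂ w5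
... | no ¬rainbow | no ¬w5 = ⊥-elim (<⇒≱ bound<n (begin
    n                                     ≡⟨ sym (List.length-tabulate {n = n} (λ i → i)) ⟩
    length (allFin n)                     ≤⟨ m≤m+n _ 0 ⟩
    -- At the start all k colours are in F and D is empty.
    length (allFin n) + 0                 ≤⟨ Upper.bounded G _ {allFin n} {allFin k} {[]} ≤-refl (Unique.allFin⁺ n) good ⟩
    bound (length (allFin k) + 0)         ≡⟨ cong bound (trans (+-identityʳ _) (List.length-tabulate {n = k} (λ i → i))) ⟩
    bound k                               ∎))
  where
  open ≤-Reasoning
  G : GallaiColouring (Fin n) (Fin k)
  G = record
    { _≟_ = Fin._≟_ ; _≟ᶜ_ = Fin._≟_ ; colour = col c ; colour-sym = Colouring.sym c
    ; no-rainbow = λ {x} {y} {z} x≢y x≢z y≢z ne → case (col c y z Fin.≟ col c x y) of λ where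
        (yes e) → inj₁ e
        (no ne₁) → inj₂ (decidable-stable (col c y z Fin.≟ col c x z) λ ne₂ →
          ¬rainbow (x , y , z , (x≢y , y≢z , x≢z) , (≢-sym ne₁ , ne₂ , ne))) }

  good : Upper.Good G (allFin n) (allFin k) []
  good = record
    { full = λ {t} _ {h} {v0} {v1} {v2} {v3} _ _ _ _ _ (h≢0 , h0) (h≢1 , h1) (h≢2 , h2) (h≢3 , h3) (n01 , e01) (n12 , e12) (n23 , e23) (n30 , e30) n02 n13 →
        ¬w5 (t , h , v0 , v1 , v2 , v3 , (h≢0 , h≢1 , h≢2 , h≢3 , n01 , n02 , ≢-sym n30 , n12 , n13 , n23) ,
          (e01 , e12 , e23 , e30 , h0 , h1 , h2 , h3))
    ; cyc = λ ()
    ; rest = λ _ _ _ _ _ _ ¬listed _ → ¬listed (inj₁ (∈-allFin _)) }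

bound-even : ∀ j → bound (2 + 2 * j) ≡ 14 * 5 ^ j
bound-even zero = refl
bound-even (suc j) = trans (cong (λ z → bound (2 + z)) (*-suc 2 j)) (trans (cong (5 *_) (bound-even j)) (times-five 14 j))

bound-odd : ∀ j → bound (3 + 2 * j) ≡ 28 * 5 ^ j
bound-odd zero = refl
bound-odd (suc j) = trans (cong (λ z → bound (3 + z)) (*-suc 2 j)) (trans (cong (5 *_) (bound-odd j)) (times-five 28 j))

isGR : ∀ {k n} → bound k ≡ n → Avoiding k n → IsGR-K3-W5 k (n + 1)
isGR {k} {n} e avoiding =
  arrows k (n + 1) (≤-reflexive (trans (cong suc e) (+-comm 1 n))) ,
  λ m m<n+1 → avoiding⇒¬arrows avoiding (≤-pred (≤-trans m<n+1 (≤-reflexive (+-comm n 1))))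

-- Even and odd k above 1 are written as 2 + 2j and 3 + 2j, so that the exponents (k - 2)/2 and (k -
-- 3)/2 both become j.
theorem7 : IsGR-K3-W5 1 5
    × (∀ j → IsGR-K3-W5 (2 + 2 * j) (14 * 5 ^ j + 1))
    × (∀ j → IsGR-K3-W5 (3 + 2 * j) (28 * 5 ^ j + 1))
theorem7 = isGR refl avoiding-1
  , (λ j → isGR (bound-even j) (iterate avoiding-2 j))
  , (λ j → isGR (bound-odd j) (iterate avoiding-3 j))
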